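{- Let $G$ be a strongly connected directed graph on a finite vertex set (self-loops allowed) and let $\beta$ be a balanced graph function on $G$. Then $\beta$ is the unique balanced graph function in its equivalence class if and only if the graph $G_\beta^w$ is strongly connected for every real $w$.
   Context: A graph function on $G$ assigns a real weight $\beta_{uv}$ to every edge $(u,v)$ of $G$. For a vertex $v$, $\beta_v^{\text{in}}=\max_{u:(u,v)\in G}\beta_{uv}$ and $\beta_v^{\text{out}}=\max_{w:(v,w)\in G}\beta_{vw}$; $\beta$ is balanced if $\beta_v^{\text{in}}=\beta_v^{\text{out}}$ for all $v$. Two graph functions $\alpha,\gamma$ on $G$ are equivalent if $\sum_{\ell=1}^k(\alpha_{v_\ell v_{\ell+1}}-\gamma_{v_\ell v_{\ell+1}})=0$ for every directed cycle $(v_1,\dots,v_k)$ of $G$ (with $v_{k+1}=v_1$). For real $w$, $G_\beta^w$ is the subgraph of $G$ consisting of the edges $(u,v)$ with $\beta_{uv}\ge w$, with isolated vertices removed (a vertex carrying a self-loop is not considered isolated). -}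

module Defs where

open import Data.Bool using (Bool; T)
open import Data.Fin using (Fin)
open import Data.List using (List; []; _∷_)
open import Data.List.Relation.Unary.Unique.Propositional using (Unique)
open import Data.Nat as ℕ using (ℕ)
import Data.Nat.Properties as ℕₚ
open import Data.Product using (Σ-syntax; ∃-syntax; _×_; _,_)
open import Data.Rational as ℚ using (ℚ; 0ℚ; ½)
import Data.Rational.Properties as ℚₚ
open import Data.Sum using (_⊎_; inj₁; inj₂)
open import Data.Unit using (⊤; tt)
open import Level using (0ℓ)
open import Relation.Binary.Core using (Rel)
open import Relation.Binary.Construct.Closure.ReflexiveTransitive using (Star; ε; _◅_)
open import Relation.Binary.PropositionalEquality using (_≡_; sym; trans; cong; subst)
open import Relation.Unary using (Pred)
import Algebra.Bundles
import Algebra.Properties.CommutativeSemigroup (Algebra.Bundles.CommutativeMonoid.commutativeSemigroup ℚₚ.+-0-commutativeMonoid) as ℚ-semigroup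

-- Real numbers: Cauchy sequences of rationals, compared with the setoid
-- equality _≈_.

IsCauchy : (ℕ → ℚ) → Set
IsCauchy s = ∀ δ → 0ℚ ℚ.< δ →
  ∃[ N ] (∀ m n → N ℕ.≤ m → N ℕ.≤ n → ℚ.∣ s m ℚ.- s n ∣ ℚ.< δ)

record ℝ : Set where
  constructor mkℝ
  field
    seq    : ℕ → ℚ
    cauchy : IsCauchy seq

open ℝ public

infix 4 _≈_ _≤_

_≈_ : Rel ℝ 0ℓ
x ≈ y = ∀ δ → 0ℚ ℚ.< δ →
  ∃[ N ] (∀ n → N ℕ.≤ n → ℚ.∣ seq x n ℚ.- seq y n ∣ ℚ.< δ)

_≤_ : Rel ℝ 0ℓ
x ≤ y = ∀ δ → 0ℚ ℚ.< δ →
  ∃[ N ] (∀ n → N ℕ.≤ n → seq x n ℚ.< seq y n ℚ.+ δ)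

private
  half-pos : ∀ δ → 0ℚ ℚ.< δ → 0ℚ ℚ.< ½ ℚ.* δ
  half-pos δ 0<δ = subst (ℚ._< ½ ℚ.* δ) (ℚₚ.*-zeroʳ ½) (ℚₚ.*-monoʳ-<-pos ½ 0<δ)

  half+half : ∀ δ → ½ ℚ.* δ ℚ.+ ½ ℚ.* δ ≡ δ
  half+half δ = trans (sym (ℚₚ.*-distribʳ-+ δ ½ ½)) (ℚₚ.*-identityˡ δ)

  +-interchange : ∀ a b c d →
    (a ℚ.+ b) ℚ.- (c ℚ.+ d) ≡ (a ℚ.- c) ℚ.+ (b ℚ.- d)
  +-interchange a b c d =
    trans (cong ((a ℚ.+ b) ℚ.+_) (ℚₚ.neg-distrib-+ c d))
          (ℚ-semigroup.interchange a b (ℚ.- c) (ℚ.- d))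

  const-cauchy : ∀ q → IsCauchy (λ _ → q)
  const-cauchy q δ 0<δ =
    0 , λ _ _ _ _ → subst (λ r → ℚ.∣ r ∣ ℚ.< δ) (sym (ℚₚ.+-inverseʳ q)) 0<δ

  +-cauchy : ∀ s t → IsCauchy s → IsCauchy t → IsCauchy (λ n → s n ℚ.+ t n)
  +-cauchy s t cs ct δ 0<δ
    with M , hM ← cs (½ ℚ.* δ) (half-pos δ 0<δ)
       | N , hN ← ct (½ ℚ.* δ) (half-pos δ 0<δ) =
    M ℕ.⊔ N , λ m n hm hn → begin-strict
      ℚ.∣ (s m ℚ.+ t m) ℚ.- (s n ℚ.+ t n) ∣
        ≡⟨ cong ℚ.∣_∣ (+-interchange (s m) (t m) (s n) (t n)) ⟩
      ℚ.∣ (s m ℚ.- s n) ℚ.+ (t m ℚ.- t n) ∣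
        ≤⟨ ℚₚ.∣p+q∣≤∣p∣+∣q∣ (s m ℚ.- s n) (t m ℚ.- t n) ⟩
      ℚ.∣ s m ℚ.- s n ∣ ℚ.+ ℚ.∣ t m ℚ.- t n ∣
        <⟨ ℚₚ.+-mono-<
             (hM m n (ℕₚ.m⊔n≤o⇒m≤o M N hm) (ℕₚ.m⊔n≤o⇒m≤o M N hn))
             (hN m n (ℕₚ.m⊔n≤o⇒n≤o M N hm) (ℕₚ.m⊔n≤o⇒n≤o M N hn)) ⟩
      ½ ℚ.* δ ℚ.+ ½ ℚ.* δ
        ≡⟨ half+half δ ⟩
      δ ∎
    where open ℚₚ.≤-Reasoning

  neg-cauchy : ∀ s → IsCauchy s → IsCauchy (λ n → ℚ.- s n)
  neg-cauchy s cs δ 0<δ with N , h ← cs δ 0<δ =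
    N , λ m n hm hn → subst (ℚ._< δ) (sym (lemma (s m) (s n))) (h m n hm hn)
    where
    lemma : ∀ a b → ℚ.∣ (ℚ.- a) ℚ.- (ℚ.- b) ∣ ≡ ℚ.∣ a ℚ.- b ∣
    lemma a b = trans (cong ℚ.∣_∣ (sym (ℚₚ.neg-distrib-+ a (ℚ.- b))))
                      (ℚₚ.∣-p∣≡∣p∣ (a ℚ.- b))

0ℝ : ℝ
0ℝ = mkℝ (λ _ → 0ℚ) (const-cauchy 0ℚ)

infixl 6 _+_ _-_
infix  8 -_

_+_ : ℝ → ℝ → ℝ
x + y = mkℝ (λ n → seq x n ℚ.+ seq y n) (+-cauchy (seq x) (seq y) (cauchy x) (cauchy y))

-_ : ℝ → ℝ
- x = mkℝ (λ n → ℚ.- seq x n) (neg-cauchy (seq x) (cauchy x))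

_-_ : ℝ → ℝ → ℝ
x - y = x + (- y)

IsMaximum : Pred ℝ 0ℓ → ℝ → Set
IsMaximum S m = (∃[ x ] S x × x ≈ m) × (∀ x → S x → x ≤ m)

-- Vertices are cut out of an ambient type A by a predicate, so that a vertex
-- of a subgraph carries no proof that would distinguish copies of it.
record Digraph (A : Set) : Set₁ where
  field
    IsVertex : Pred A 0ℓ
    Edge     : Rel A 0ℓ
    source   : ∀ {u v} → Edge u v → IsVertex u
    target   : ∀ {u v} → Edge u v → IsVertex v

-- The digraph without vertices counts as strongly connected.
StronglyConnected : ∀ {A} → Digraph A → Set
StronglyConnected G = ∀ u v → IsVertex u → IsVertex v → Star Edge u v
  where open Digraph G

-- Digraphs on a finite vertex set with at most one edge for each ordered pair.
record FiniteDigraph : Set where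
  field
    size : ℕ
    adj  : Fin size → Fin size → Bool

  Vertex : Set
  Vertex = Fin size

  Edge : Rel Vertex 0ℓ
  Edge u v = T (adj u v)

  digraph : Digraph Vertex
  digraph = record
    { IsVertex = λ _ → ⊤
    ; Edge     = Edge
    ; source   = λ _ → tt
    ; target   = λ _ → tt
    }

module _ (G : FiniteDigraph) where
  open FiniteDigraph G

  GraphFunction : Set
  GraphFunction = ∀ u v → Edge u v → ℝ

  -- The vertices of a walk other than its last one; for a closed walk
  -- v₁ → ⋯ → vₖ → v₁ this is the list v₁ , … , vₖ.
  sources : ∀ {u v} → Star Edge u v → List Vertex
  sources ε                = []
  sources (_◅_ {u} _ walk) = u ∷ sources walk

  sumAlong : ∀ {u v} → GraphFunction → Star Edge u v → ℝ
  sumAlong f ε                    = 0ℝ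
  sumAlong f (_◅_ {u} {v} e walk) = f u v e + sumAlong f walk

  -- Cycles of length 1 are the self-loops.
  record Cycle : Set where
    field
      {v₁ v₂}  : Vertex
      edge     : Edge v₁ v₂
      return   : Star Edge v₂ v₁

    walk : Star Edge v₁ v₁
    walk = edge ◅ return

    field
      distinct : Unique (sources walk)

  Equivalent : Rel GraphFunction 0ℓ
  Equivalent α γ = ∀ (c : Cycle) →
    sumAlong (λ u v e → α u v e - γ u v e) (Cycle.walk c) ≈ 0ℝ

  InWeight : GraphFunction → Vertex → Pred ℝ 0ℓ
  InWeight β v x = ∃[ u ] Σ[ e ∈ Edge u v ] x ≈ β u v e

  OutWeight : GraphFunction → Vertex → Pred ℝ 0ℓ
  OutWeight β v x = ∃[ w ] Σ[ e ∈ Edge v w ] x ≈ β v w e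

  -- The maxima are quantified over, since a maximum over an empty set does
  -- not exist. In a strongly connected digraph that case arises only for a
  -- single vertex without self-loop, where there are no weights at all.
  Balanced : GraphFunction → Set
  Balanced β = ∀ v βᵢₙ βₒᵤₜ →
    IsMaximum (InWeight β v) βᵢₙ → IsMaximum (OutWeight β v) βₒᵤₜ → βᵢₙ ≈ βₒᵤₜ

  IsUniqueBalanced : GraphFunction → Set
  IsUniqueBalanced β = Balanced β ×
    (∀ γ → Balanced γ → Equivalent β γ → ∀ u v (e : Edge u v) → γ u v e ≈ β u v e)

  HeavyEdge : GraphFunction → ℝ → Rel Vertex 0ℓ
  HeavyEdge β w u v = Σ[ e ∈ Edge u v ] w ≤ β u v e

  -- The digraph written G with subscript β and superscript w.
  threshold : GraphFunction → ℝ → Digraph Vertex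
  threshold β w = record
    { IsVertex = λ v → (∃[ u ] HeavyEdge β w u v) ⊎ (∃[ u ] HeavyEdge β w v u)
    ; Edge     = HeavyEdge β w
    ; source   = λ {u} {v} e → inj₂ (v , e)
    ; target   = λ {u} {v} e → inj₁ (u , e)
    }

{-# OPTIONS --safe #-}
module Submission where

-- Summing β - γ along walks shows that equivalent graph functions differ by a potential:
-- γ u v = β u v + (p u - p v).
--
-- Threshold graphs strongly connected ⇒ unique. Let w be the largest weight such that p is not
-- constant on the threshold graph at w. The endpoints of edges heavier than w share one value of p,
-- so they miss the maximisers or the minimisers of p; say the maximisers. A heavy edge leaving that
-- set would have γ-weight above w, and balance of γ would give an endless backward chain of such
-- edges along which p strictly increases.
--
-- Unique ⇒ threshold graphs strongly connected. Let v be unreachable from u at level w. Following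
-- edges of maximal out-weight from u leads to a terminal class S, and following edges of maximal
-- in-weight backwards from v leads to an initial class C; both use edges of weight at least w only,
-- so S and C are disjoint. For a small η > 0 prescribe p = η on S and p = 0 on C. Elsewhere balance
-- is a monotone fixed-point equation, which Knaster–Tarski solves in [0, η]; on S and C the maximal
-- edges inside the class keep the balance. This p is not constant.

open import Axiom.ExcludedMiddle using (ExcludedMiddle)
open import Data.Bool using (true; false; T)
open import Data.Fin using (Fin; _≟_)
open import Data.Integer as ℤ using (+_)
import Data.Integer.Properties as ℤₚ
open import Data.List using (List; []; _∷_; concatMap; map; allFin)
import Data.List.Membership.DecPropositional as DecMembership
open import Data.List.Membership.Propositional using (_∈_)
open import Data.List.Membership.Propositional.Properties using (∈-allFin; ∈-map⁺; ∈-concatMap⁺)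
open import Data.List.Relation.Unary.All as All using (All; []; _∷_)
open import Data.List.Relation.Unary.AllPairs using ([]; _∷_)
open import Data.List.Relation.Unary.Any as Any using (here; there)
open import Data.List.Relation.Unary.Unique.Propositional using (Unique)
open import Data.Nat as ℕ using (ℕ; zero; suc)
import Data.Nat.Properties as ℕₚ
open import Data.Product using (Σ-syntax; ∃-syntax; _×_; _,_; proj₁; proj₂)
open import Data.Rational as ℚ using (ℚ; 0ℚ; 1ℚ; ½)
import Data.Rational.Properties as ℚₚ
open import Data.Rational.Solver using (module +-*-Solver)
import Data.Rational.Unnormalised as ℚᵘ
import Data.Rational.Unnormalised.Properties as ℚᵘₚ
open import Data.Sum using (_⊎_; inj₁; inj₂; [_,_]′)
open import Data.Unit using (⊤; tt)
open import Function using (_∘_; id)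
open import Function.Bundles using (_⇔_; mk⇔)
open import Level using (0ℓ)
open import Relation.Binary.Construct.Closure.ReflexiveTransitive as Star using (Star; ε; _◅_; _◅◅_)
open import Relation.Binary.PropositionalEquality using (_≡_; _≢_; refl; sym; trans; cong; subst)
open import Relation.Nullary using (¬_; Dec; yes; no; contradiction)
open import Relation.Unary using (Pred)
open import Defs
open +-*-Solver using (solve; _:=_; _:+_; _:-_; :-_; _:*_; con)

-- Estimates for rational numbers.

½-positive : ∀ {δ} → 0ℚ ℚ.< δ → 0ℚ ℚ.< ½ ℚ.* δ
½-positive {δ} 0<δ = subst (ℚ._< ½ ℚ.* δ) (ℚₚ.*-zeroʳ ½) (ℚₚ.*-monoʳ-<-pos ½ 0<δ)

p<p+δ : ∀ p {δ} → 0ℚ ℚ.< δ → p ℚ.< p ℚ.+ δ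
p<p+δ p {δ} 0<δ = subst (ℚ._< p ℚ.+ δ) (ℚₚ.+-identityʳ p) (ℚₚ.+-monoʳ-< p 0<δ)

p≤∣p∣ : ∀ p → p ℚ.≤ ℚ.∣ p ∣
p≤∣p∣ p with ℚₚ.∣p∣≡p∨∣p∣≡-p p
... | inj₁ eq = ℚₚ.≤-reflexive (sym eq)
... | inj₂ eq with ℚₚ.≤-total 0ℚ p
...   | inj₁ 0≤p = ℚₚ.≤-reflexive (sym (ℚₚ.0≤p⇒∣p∣≡p 0≤p))
...   | inj₂ p≤0 = ℚₚ.≤-trans p≤0 (ℚₚ.0≤∣p∣ p)

∣p-q∣<δ⇒p<q+δ : ∀ {p q δ} → ℚ.∣ p ℚ.- q ∣ ℚ.< δ → p ℚ.< q ℚ.+ δ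
∣p-q∣<δ⇒p<q+δ {p} {q} {δ} h =
  subst (ℚ._< q ℚ.+ δ) (solve 2 (λ p q → q :+ (p :- q) := p) refl p q)
    (ℚₚ.+-monoʳ-< q (ℚₚ.≤-<-trans (p≤∣p∣ (p ℚ.- q)) h))

∣p-q∣<δ⇒q<p+δ : ∀ {p q δ} → ℚ.∣ p ℚ.- q ∣ ℚ.< δ → q ℚ.< p ℚ.+ δ
∣p-q∣<δ⇒q<p+δ {p} {q} {δ} h = ∣p-q∣<δ⇒p<q+δ
  (subst (ℚ._< δ) (trans (sym (ℚₚ.∣-p∣≡∣p∣ (p ℚ.- q)))
    (cong ℚ.∣_∣ (solve 2 (λ p q → :- (p :- q) := q :- p) refl p q))) h)

p<q+δ⇒p-q<δ : ∀ {p q δ} → p ℚ.< q ℚ.+ δ → p ℚ.- q ℚ.< δ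
p<q+δ⇒p-q<δ {p} {q} {δ} h =
  subst (p ℚ.- q ℚ.<_) (solve 2 (λ q δ → q :+ δ :- q := δ) refl q δ) (ℚₚ.+-monoˡ-< (ℚ.- q) h)

∣p-q∣<δ : ∀ {p q δ} → p ℚ.< q ℚ.+ δ → q ℚ.< p ℚ.+ δ → ℚ.∣ p ℚ.- q ∣ ℚ.< δ
∣p-q∣<δ {p} {q} {δ} h k with ℚₚ.∣p∣≡p∨∣p∣≡-p (p ℚ.- q)
... | inj₁ eq = subst (ℚ._< δ) (sym eq) (p<q+δ⇒p-q<δ h)
... | inj₂ eq = subst (ℚ._< δ)
  (sym (trans eq (solve 2 (λ p q → :- (p :- q) := q :- p) refl p q))) (p<q+δ⇒p-q<δ k)

<-chain : ∀ {p q r δ η θ} → p ℚ.< q ℚ.+ δ → q ℚ.< r ℚ.+ η → δ ℚ.+ η ≡ θ → p ℚ.< r ℚ.+ θ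
<-chain {p} {q} {r} {δ} {η} h k refl = ℚₚ.<-trans h
  (subst (q ℚ.+ δ ℚ.<_) (solve 3 (λ r δ η → r :+ η :+ δ := r :+ (δ :+ η)) refl r δ η)
    (ℚₚ.+-monoˡ-< δ k))

½+½ : ∀ δ → ½ ℚ.* δ ℚ.+ ½ ℚ.* δ ≡ δ
½+½ = solve 1 (λ δ → con ½ :* δ :+ con ½ :* δ := δ) refl

-- Order and addition on Cauchy reals.

-- Unfolding the definition of x ≤ y loses x and y to unification; the wrapper keeps them inferable.
infix 4 _≼_ _≋_ _≺_

record _≼_ (x y : ℝ) : Set where
  constructor wrap
  field unwrap : x ≤ y

open _≼_

_≋_ : ℝ → ℝ → Set
x ≋ y = x ≼ y × y ≼ x

_≺_ : ℝ → ℝ → Set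
x ≺ y = ¬ y ≼ x

≼-trans : ∀ {x y z} → x ≼ y → y ≼ z → x ≼ z
≼-trans {x} {y} {z} (wrap x≤y) (wrap y≤z) = wrap go
  where
  go : x ≤ z
  go δ 0<δ
    with M , hM ← x≤y (½ ℚ.* δ) (½-positive 0<δ)
       | N , hN ← y≤z (½ ℚ.* δ) (½-positive 0<δ) =
    M ℕ.⊔ N , λ n h → <-chain {seq x n} {seq y n} {seq z n}
      (hM n (ℕₚ.m⊔n≤o⇒m≤o M N h)) (hN n (ℕₚ.m⊔n≤o⇒n≤o M N h)) (½+½ δ)

≋⇒≈ : ∀ {x y} → x ≋ y → x ≈ y
≋⇒≈ {x} {y} (wrap x≤y , wrap y≤x) δ 0<δ with M , hM ← x≤y δ 0<δ | N , hN ← y≤x δ 0<δ =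
  M ℕ.⊔ N , λ n h → ∣p-q∣<δ {seq x n} {seq y n} (hM n (ℕₚ.m⊔n≤o⇒m≤o M N h)) (hN n (ℕₚ.m⊔n≤o⇒n≤o M N h))

≈⇒≋ : ∀ {x y} → x ≈ y → x ≋ y
≈⇒≋ {x} {y} x≈y = wrap x≤y , wrap y≤x
  where
  x≤y : x ≤ y
  x≤y δ 0<δ with N , h ← x≈y δ 0<δ = N , λ n N≤n → ∣p-q∣<δ⇒p<q+δ {seq x n} {seq y n} (h n N≤n)
  y≤x : y ≤ x
  y≤x δ 0<δ with N , h ← x≈y δ 0<δ = N , λ n N≤n → ∣p-q∣<δ⇒q<p+δ {seq x n} {seq y n} (h n N≤n)

pointwise-≼ : ∀ {x y} → (∀ n → seq x n ℚ.≤ seq y n) → x ≼ y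
pointwise-≼ {x} {y} h = wrap λ δ 0<δ → 0 , λ n _ → ℚₚ.≤-<-trans (h n) (p<p+δ (seq y n) 0<δ)

≼-refl : ∀ {x} → x ≼ x
≼-refl = pointwise-≼ λ _ → ℚₚ.≤-refl

≋-refl : ∀ {x} → x ≋ x
≋-refl = ≼-refl , ≼-refl

≈-refl : ∀ x → x ≈ x
≈-refl x = ≋⇒≈ (≋-refl {x})

≋-sym : ∀ {x y} → x ≋ y → y ≋ x
≋-sym (x≼y , y≼x) = y≼x , x≼y

≋-trans : ∀ {x y z} → x ≋ y → y ≋ z → x ≋ z
≋-trans (x≼y , y≼x) (y≼z , z≼y) = ≼-trans x≼y y≼z , ≼-trans z≼y y≼x

+-mono-≼ : ∀ {a b c d} → a ≼ b → c ≼ d → a + c ≼ b + d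
+-mono-≼ {a} {b} {c} {d} (wrap a≤b) (wrap c≤d) = wrap go
  where
  go : a + c ≤ b + d
  go δ 0<δ
    with M , hM ← a≤b (½ ℚ.* δ) (½-positive 0<δ)
       | N , hN ← c≤d (½ ℚ.* δ) (½-positive 0<δ) =
    M ℕ.⊔ N , λ n h → subst (seq a n ℚ.+ seq c n ℚ.<_)
      (solve 3 (λ b d δ → b :+ con ½ :* δ :+ (d :+ con ½ :* δ) := b :+ d :+ δ) refl (seq b n) (seq d n) δ)
      (ℚₚ.+-mono-< (hM n (ℕₚ.m⊔n≤o⇒m≤o M N h)) (hN n (ℕₚ.m⊔n≤o⇒n≤o M N h)))

+-cong : ∀ {a b c d} → a ≋ b → c ≋ d → a + c ≋ b + d
+-cong (a≼b , b≼a) (c≼d , d≼c) = +-mono-≼ a≼b c≼d , +-mono-≼ b≼a d≼c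

-- The equation says y - x = b - a with subtractions moved across; the ring solver of ℚ proves its instances.
linear-≼ : ∀ {a b x y} → a ≼ b → (∀ n → seq a n ℚ.+ seq y n ≡ seq b n ℚ.+ seq x n) → x ≼ y
linear-≼ {a} {b} {x} {y} (wrap a≤b) eq = wrap go
  where
  go : x ≤ y
  go δ 0<δ with N , h ← a≤b δ 0<δ = N , λ n N≤n →
    subst (ℚ._< seq y n ℚ.+ δ)
      (trans (solve 3 (λ a b y → y :- b :+ a := a :+ y :- b) refl (seq a n) (seq b n) (seq y n))
        (trans (cong (ℚ._- seq b n) (eq n))
          (solve 2 (λ b x → b :+ x :- b := x) refl (seq b n) (seq x n))))
      (subst (seq y n ℚ.- seq b n ℚ.+ seq a n ℚ.<_)
        (solve 3 (λ b y δ → y :- b :+ (b :+ δ) := y :+ δ) refl (seq b n) (seq y n) δ)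
        (ℚₚ.+-monoʳ-< (seq y n ℚ.- seq b n) (h n N≤n)))

linear-≋ : ∀ {a b x y} → a ≋ b → (∀ n → seq a n ℚ.+ seq y n ≡ seq b n ℚ.+ seq x n) → x ≋ y
linear-≋ (a≼b , b≼a) eq = linear-≼ a≼b eq , linear-≼ b≼a (λ n → sym (eq n))

pointwise-≋ : ∀ {x y} → (∀ n → seq x n ≡ seq y n) → x ≋ y
pointwise-≋ eq = linear-≋ (≋-refl {0ℝ}) λ n → cong (0ℚ ℚ.+_) (sym (eq n))

-- Needed for the average in the fixed-point equation. Halving shrinks distances, so the Cauchy
-- modulus of `x` is reused.
half : ℝ → ℝ
half x = mkℝ (λ n → ½ ℚ.* seq x n) λ δ 0<δ →
  let N , h = cauchy x δ 0<δ in
  N , λ m n N≤m N≤n → ℚₚ.≤-<-trans (bound (seq x m) (seq x n)) (h m n N≤m N≤n)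
  where
  bound : ∀ p q → ℚ.∣ ½ ℚ.* p ℚ.- ½ ℚ.* q ∣ ℚ.≤ ℚ.∣ p ℚ.- q ∣
  bound p q = begin
    ℚ.∣ ½ ℚ.* p ℚ.- ½ ℚ.* q ∣
      ≡⟨ cong ℚ.∣_∣ (solve 2 (λ p q → con ½ :* p :- con ½ :* q := con ½ :* (p :- q)) refl p q) ⟩
    ℚ.∣ ½ ℚ.* (p ℚ.- q) ∣    ≡⟨ ℚₚ.∣p*q∣≡∣p∣*∣q∣ ½ (p ℚ.- q) ⟩
    ½ ℚ.* ℚ.∣ p ℚ.- q ∣      ≤⟨ ℚₚ.*-monoʳ-≤-nonNeg ℚ.∣ p ℚ.- q ∣ {{ℚₚ.∣-∣-nonNeg (p ℚ.- q)}} {½} {1ℚ}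
                                  (ℚ.*≤* (ℤ.+≤+ (ℕ.s≤s ℕ.z≤n))) ⟩
    1ℚ ℚ.* ℚ.∣ p ℚ.- q ∣     ≡⟨ ℚₚ.*-identityˡ _ ⟩
    ℚ.∣ p ℚ.- q ∣            ∎
    where open ℚₚ.≤-Reasoning

half-mono-≼ : ∀ {x y} → x ≼ y → half x ≼ half y
half-mono-≼ {x} {y} (wrap x≤y) = wrap go
  where
  go : half x ≤ half y
  -- Halving turns the tolerance `δ + δ` into `δ`.
  go δ 0<δ with N , h ← x≤y (δ ℚ.+ δ) (ℚₚ.+-mono-< 0<δ 0<δ) = N , λ n N≤n →
    subst (½ ℚ.* seq x n ℚ.<_)
      (solve 2 (λ y δ → con ½ :* (y :+ (δ :+ δ)) := con ½ :* y :+ δ) refl (seq y n) δ)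
      (ℚₚ.*-monoʳ-<-pos ½ (h n N≤n))

-- Rational approximation of reals.

const : ℚ → ℝ
const q = mkℝ (λ _ → q) λ δ 0<δ →
  0 , λ _ _ _ _ → subst (λ r → ℚ.∣ r ∣ ℚ.< δ) (sym (ℚₚ.+-inverseʳ q)) 0<δ

≼-approx : ∀ {x y} → (∀ δ → 0ℚ ℚ.< δ → x ≼ y + const δ) → x ≼ y
≼-approx {x} {y} h = wrap go
  where
  go : x ≤ y
  go δ 0<δ with N , k ← unwrap (h (½ ℚ.* δ) (½-positive 0<δ)) (½ ℚ.* δ) (½-positive 0<δ) =
    N , λ n N≤n → subst (seq x n ℚ.<_)
      (solve 2 (λ y δ → y :+ con ½ :* δ :+ con ½ :* δ := y :+ δ) refl (seq y n) δ) (k n N≤n)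

-- A late term is within `½ * δ` of all later ones; raised by `½ * δ` it bounds `x` and stays within
-- `δ` of it.
rational-above : ∀ x δ → 0ℚ ℚ.< δ → ∃[ q ] x ≼ const q × const q ≼ x + const δ
rational-above x δ 0<δ with N , h ← cauchy x (½ ℚ.* δ) (½-positive 0<δ) =
  seq x N ℚ.+ ½ ℚ.* δ ,
  wrap (λ η 0<η → N , λ n N≤n →
    ℚₚ.<-trans (∣p-q∣<δ⇒p<q+δ {seq x n} {seq x N} (h n N N≤n ℕₚ.≤-refl)) (p<p+δ _ 0<η)) ,
  wrap (λ η 0<η → N , λ n N≤n →
    ℚₚ.<-trans
      (subst (seq x N ℚ.+ ½ ℚ.* δ ℚ.<_)
        (solve 2 (λ x δ → x :+ con ½ :* δ :+ con ½ :* δ := x :+ δ) refl (seq x n) δ)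
        (ℚₚ.+-monoˡ-< (½ ℚ.* δ) (∣p-q∣<δ⇒p<q+δ {seq x N} {seq x n} (h N n ℕₚ.≤-refl N≤n))))
      (p<p+δ _ 0<η))

-- The term of `x` at `n` is close to a much later term of `x`, and late terms of `x` nearly lie
-- below the constant `s n`.
≼-const-terms : ∀ {x} → (s : ℕ → ℚ) → (cs : IsCauchy s) → (∀ n → x ≼ const (s n)) → x ≼ mkℝ s cs
≼-const-terms {x} s cs h = wrap go
  where
  go : x ≤ mkℝ s cs
  go δ 0<δ with M , hM ← cauchy x (½ ℚ.* δ) (½-positive 0<δ) = M , λ n M≤n →
    let N , hN = unwrap (h n) (½ ℚ.* δ) (½-positive 0<δ) in
    <-chain {seq x n} {seq x (M ℕ.⊔ N)} {s n}
      (∣p-q∣<δ⇒p<q+δ {seq x n} {seq x (M ℕ.⊔ N)} (hM n (M ℕ.⊔ N) M≤n (ℕₚ.m≤m⊔n M N)))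
      (hN (M ℕ.⊔ N) (ℕₚ.m≤n⊔m M N)) (½+½ δ)

-- The Archimedean property and vanishing grid widths.

ι : ℕ → ℚ
ι zero    = 0ℚ
ι (suc n) = 1ℚ ℚ.+ ι n

toℚᵘ-ι : ∀ n → ℚ.toℚᵘ (ι n) ℚᵘ.≃ ℚᵘ.mkℚᵘ (+ n) 0
toℚᵘ-ι zero    = ℚᵘ.*≡* refl
toℚᵘ-ι (suc n) = ℚᵘₚ.≃-trans (ℚₚ.toℚᵘ-homo-+ 1ℚ (ι n))
  (ℚᵘₚ.≃-trans (ℚᵘₚ.+-congʳ (ℚ.toℚᵘ 1ℚ) (toℚᵘ-ι n))
    (ℚᵘ.*≡* (cong (λ k → k ℤ.* + 1) (cong (ℤ._+_ (+ 1)) (ℤₚ.*-identityʳ (+ n))))))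

-- A denominator is at least 1, so the absolute value of the numerator is a bound.
archimedean : ∀ q → ∃[ n ] q ℚ.≤ ι n
archimedean q = ℤ.∣ ℚ.numerator q ∣ , ℚₚ.toℚᵘ-cancel-≤
  (ℚᵘₚ.≤-respʳ-≃ (ℚᵘₚ.≃-sym (toℚᵘ-ι ℤ.∣ ℚ.numerator q ∣)) (bound q))
  where
  bound : ∀ q → ℚ.toℚᵘ q ℚᵘ.≤ ℚᵘ.mkℚᵘ (+ ℤ.∣ ℚ.numerator q ∣) 0
  bound (ℚ.mkℚ (+ n) d _) = ℚᵘ.*≤*
    (ℤₚ.*-monoˡ-≤-nonNeg (+ n) (ℤ.+≤+ (ℕ.s≤s (ℕ.z≤n {d}))))
  bound (ℚ.mkℚ ℤ.-[1+ n ] d _) = ℚᵘ.*≤* ℤ.-≤+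

ι-nonNegative : ∀ n → 0ℚ ℚ.≤ ι n
ι-nonNegative zero    = ℚₚ.≤-refl
ι-nonNegative (suc n) = ℚₚ.+-mono-≤ (ℚₚ.<⇒≤ (ℚₚ.positive⁻¹ 1ℚ)) (ι-nonNegative n)

ι-mono-≤ : ∀ {m n} → m ℕ.≤ n → ι m ℚ.≤ ι n
ι-mono-≤ {n = n} ℕ.z≤n = ι-nonNegative n
ι-mono-≤ (ℕ.s≤s m≤n)   = ℚₚ.+-monoʳ-≤ 1ℚ (ι-mono-≤ m≤n)

ι-suc-positive : ∀ n → 0ℚ ℚ.< ι (suc n)
ι-suc-positive n = ℚₚ.+-mono-<-≤ (ℚₚ.positive⁻¹ 1ℚ) (ι-nonNegative n)

ι-suc-nonZero : ∀ n → ℚ.NonZero (ι (suc n))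
ι-suc-nonZero n = ℚₚ.pos⇒nonZero (ι (suc n)) {{ℚ.positive (ι-suc-positive n)}}

archimedean-step : ∀ q {h} → 0ℚ ℚ.< h → ∃[ n ] q ℚ.≤ ι n ℚ.* h
archimedean-step q {h} 0<h =
  let n , q/h≤n = archimedean (q ℚ.* 1/h) in
  n , subst (ℚ._≤ ι n ℚ.* h)
        (trans (ℚₚ.*-assoc q 1/h h)
          (trans (cong (q ℚ.*_) (ℚₚ.*-inverseˡ h {{h≢0}})) (ℚₚ.*-identityʳ q)))
        (ℚₚ.*-monoʳ-≤-nonNeg h {{ℚ.nonNegative (ℚₚ.<⇒≤ 0<h)}} q/h≤n)
  where
  h≢0 = ℚ.>-nonZero 0<h
  1/h = (ℚ.1/ h) {{h≢0}}

mesh : ℕ → ℚ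
mesh n = (ℚ.1/ ι (suc n)) {{ι-suc-nonZero n}}

mesh-positive : ∀ n → 0ℚ ℚ.< mesh n
mesh-positive n = ℚₚ.positive⁻¹ (mesh n)
  {{ℚₚ.1/pos⇒pos (ι (suc n)) {{ℚ.positive (ι-suc-positive n)}}}}

-- Choose `N` with `1 ≤ N * δ`; then `1 < (n + 1) * δ` for every `n ≥ N`, and dividing by `n + 1`
-- gives the bound.
mesh-vanishes : ∀ {δ} → 0ℚ ℚ.< δ → ∃[ N ] (∀ n → N ℕ.≤ n → mesh n ℚ.< δ)
mesh-vanishes {δ} 0<δ =
  let N , 1≤Nδ = archimedean-step 1ℚ 0<δ in
  N , λ n N≤n → begin-strict
    mesh n                         ≡⟨ sym (ℚₚ.*-identityʳ (mesh n)) ⟩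
    mesh n ℚ.* 1ℚ                  ≤⟨ *ˡ n 1≤Nδ ⟩
    mesh n ℚ.* (ι N ℚ.* δ)         ≤⟨ *ˡ n (ℚₚ.*-monoʳ-≤-nonNeg δ {{ℚ.nonNegative (ℚₚ.<⇒≤ 0<δ)}} (ι-mono-≤ N≤n)) ⟩
    mesh n ℚ.* (ι n ℚ.* δ)         <⟨ ℚₚ.*-monoʳ-<-pos (mesh n) {{ℚ.positive (mesh-positive n)}}
                                        (ℚₚ.*-monoˡ-<-pos δ {{ℚ.positive 0<δ}} (ιn<1+ιn n)) ⟩
    mesh n ℚ.* (ι (suc n) ℚ.* δ)   ≡⟨ sym (ℚₚ.*-assoc (mesh n) (ι (suc n)) δ) ⟩
    mesh n ℚ.* ι (suc n) ℚ.* δ     ≡⟨ cong (ℚ._* δ) (ℚₚ.*-inverseˡ (ι (suc n)) {{ι-suc-nonZero n}}) ⟩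
    1ℚ ℚ.* δ                       ≡⟨ ℚₚ.*-identityˡ δ ⟩
    δ                              ∎
  where
  open ℚₚ.≤-Reasoning
  *ˡ : ∀ n {p q} → p ℚ.≤ q → mesh n ℚ.* p ℚ.≤ mesh n ℚ.* q
  *ˡ n = ℚₚ.*-monoˡ-≤-nonNeg (mesh n) {{ℚ.nonNegative (ℚₚ.<⇒≤ (mesh-positive n))}}
  ιn<1+ιn : ∀ n → ι n ℚ.< ι (suc n)
  ιn<1+ιn n = subst (ℚ._< ι (suc n)) (ℚₚ.+-identityˡ (ι n)) (ℚₚ.+-monoˡ-< (ι n) (ℚₚ.positive⁻¹ 1ℚ))

const-mono-≼ : ∀ {p q} → p ℚ.≤ q → const p ≼ const q
const-mono-≼ p≤q = pointwise-≼ λ _ → p≤q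

const-positive : ∀ {δ} → 0ℚ ℚ.< δ → 0ℝ ≺ const δ
const-positive {δ} 0<δ (wrap δ≤0) with N , h ← δ≤0 δ 0<δ =
  ℚₚ.<-irrefl refl (subst (δ ℚ.<_) (ℚₚ.+-identityˡ δ) (h N ℕₚ.≤-refl))

-- Classical order theory: totality, infima, fixed points.

module Classical (em : ExcludedMiddle 0ℓ) where

  by-contradiction : ∀ {P : Set} → ¬ ¬ P → P
  by-contradiction {P} ¬¬p with em {P}
  ... | yes p = p
  ... | no ¬p = contradiction ¬p ¬¬p

  abstract
    -- If the terms of `y` never drop to those of `x` beyond the Cauchy moduli, then `x ≼ y`.
    -- Otherwise a single such index, carried along by the Cauchy property, bounds all later terms.
    ≼-total : ∀ x y → x ≼ y ⊎ y ≼ x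
    ≼-total x y with em {x ≼ y}
    ... | yes x≼y = inj₁ x≼y
    ... | no  x⋠y = inj₂ (wrap go)
      where
      go : y ≤ x
      go δ 0<δ with M , hM ← cauchy x (½ ℚ.* δ) (½-positive 0<δ)
                  | N , hN ← cauchy y (½ ℚ.* δ) (½-positive 0<δ)
                  with em {∃[ n ] M ℕ.⊔ N ℕ.≤ n × seq y n ℚ.≤ seq x n}
      ... | no never = contradiction (wrap λ η 0<η → M ℕ.⊔ N , λ n h →
              ℚₚ.<-trans (ℚₚ.≰⇒> (λ y≤x → never (n , h , y≤x))) (p<p+δ (seq y n) 0<η)) x⋠y
      ... | yes (n , h , yn≤xn) = M ℕ.⊔ N , λ m k →
              <-chain {seq y m} {seq x n} {seq x m}
                (ℚₚ.<-≤-trans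
                  (∣p-q∣<δ⇒p<q+δ {seq y m} {seq y n} (hN m n (ℕₚ.m⊔n≤o⇒n≤o M N k) (ℕₚ.m⊔n≤o⇒n≤o M N h)))
                  (ℚₚ.+-monoˡ-≤ (½ ℚ.* δ) yn≤xn))
                (∣p-q∣<δ⇒p<q+δ {seq x n} {seq x m} (hM n m (ℕₚ.m⊔n≤o⇒m≤o M N h) (ℕₚ.m⊔n≤o⇒m≤o M N k)))
                (½+½ δ)

  ≺⇒≼ : ∀ {x y} → x ≺ y → x ≼ y
  ≺⇒≼ {x} {y} x≺y with ≼-total x y
  ... | inj₁ x≼y = x≼y
  ... | inj₂ y≼x = contradiction y≼x x≺y

  crossing : (U : ℕ → Set) → ¬ U 0 → ∀ n → U n → ∃[ k ] ¬ U k × U (suc k)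
  crossing U ¬U0 zero    Un = contradiction Un ¬U0
  crossing U ¬U0 (suc n) Un with em {U n}
  ... | yes Un′ = crossing U ¬U0 n Un′
  ... | no ¬Un′ = n , ¬Un′ , Un

  -- The infimum is the cut between rationals that are `Above` some element of `P` and those that
  -- are not, located on grids of width `mesh n`.
  module Infimum (P : Pred ℝ 0ℓ) (x₀ : ℝ) (x₀∈P : P x₀) (l : ℝ) (l-lower : ∀ x → P x → l ≼ x) where

    Above : ℚ → Set
    Above q = ∃[ x ] P x × x ≼ const q

    Above-upward : ∀ {p q} → p ℚ.≤ q → Above p → Above q
    Above-upward p≤q (x , x∈P , x≼p) = x , x∈P , ≼-trans x≼p (const-mono-≼ p≤q)

    some-above : ∃[ q ] Above q
    some-above = let q , x₀≼q , _ = rational-above x₀ 1ℚ (ℚₚ.positive⁻¹ 1ℚ) in q , x₀ , x₀∈P , x₀≼q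

    some-not-above : ∃[ q ] ¬ Above q
    some-not-above = let q , -l≼q , _ = rational-above (- l) 1ℚ (ℚₚ.positive⁻¹ 1ℚ) in
      -- Since `q` bounds `- l`, this rational lies at least 1 below the lower bound `l`.
      ℚ.- q ℚ.- 1ℚ , λ (x , x∈P , x≼) → const-positive (ℚₚ.positive⁻¹ 1ℚ)
        (linear-≼ (+-mono-≼ -l≼q (≼-trans (l-lower x x∈P) x≼)) λ n →
          solve 2 (λ l q → :- l :+ l :+ con 0ℚ := q :+ (:- q :- con 1ℚ) :+ con 1ℚ) refl (seq l n) q)

    -- Steps of width `h` lead from a rational that is not `Above` past one that is; somewhere
    -- between two neighbouring steps the predicate switches.
    grid-point : ∀ h → 0ℚ ℚ.< h → ∃[ q ] Above (q ℚ.+ h) × ¬ Above q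
    grid-point h 0<h =
      let a , Above-a = some-above
          b , ¬Above-b = some-not-above
          f = λ k → b ℚ.+ ι k ℚ.* h
          n , a-b≤nh = archimedean-step (a ℚ.- b) 0<h
          k , ¬Uk , U1+k = crossing (Above ∘ f)
            (subst (¬_ ∘ Above) (solve 2 (λ b h → b := b :+ con 0ℚ :* h) refl b h) ¬Above-b) n
            (Above-upward (subst (ℚ._≤ f n) (solve 2 (λ a b → b :+ (a :- b) := a) refl a b)
              (ℚₚ.+-monoʳ-≤ b a-b≤nh)) Above-a)
      in f k , subst Above (solve 3 (λ b i h → b :+ (con 1ℚ :+ i) :* h := b :+ i :* h :+ h) refl b (ι k) h) U1+k , ¬Uk

    lower upper : ℕ → ℚ
    lower n = proj₁ (grid-point (mesh n) (mesh-positive n))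
    upper n = lower n ℚ.+ mesh n

    upper-above : ∀ n → Above (upper n)
    upper-above n = proj₁ (proj₂ (grid-point (mesh n) (mesh-positive n)))

    lower-below : ∀ n {q} → Above q → lower n ℚ.< q
    lower-below n Above-q = ℚₚ.≰⇒> λ q≤lower →
      proj₂ (proj₂ (grid-point (mesh n) (mesh-positive n))) (Above-upward q≤lower Above-q)

    upper-close : ∀ {δ} n {q} → mesh n ℚ.< δ → Above q → upper n ℚ.< q ℚ.+ δ
    upper-close n mesh<δ Above-q = ℚₚ.+-mono-< (lower-below n Above-q) mesh<δ

    upper-cauchy : IsCauchy upper
    upper-cauchy δ 0<δ = let N , small = mesh-vanishes 0<δ in N , λ m n N≤m N≤n →
      ∣p-q∣<δ (upper-close m (small m N≤m) (upper-above n)) (upper-close n (small n N≤n) (upper-above m))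

    inf : ℝ
    inf = mkℝ upper upper-cauchy

    inf-≼ : ∀ {x} → P x → inf ≼ x
    inf-≼ {x} x∈P = ≼-approx λ δ 0<δ →
      let q , x≼q , q≼x+δ = rational-above x δ 0<δ in
      ≼-trans (wrap λ η 0<η → let N , small = mesh-vanishes 0<η in
        N , λ n N≤n → upper-close n (small n N≤n) (x , x∈P , x≼q)) q≼x+δ

    inf-greatest : ∀ {y} → (∀ x → P x → y ≼ x) → y ≼ inf
    inf-greatest y-lower = ≼-const-terms upper upper-cauchy λ n →
      let x , x∈P , x≼ = upper-above n in ≼-trans (y-lower x x∈P) x≼

  abstract
    -- The least fixed point between `lo` and `hi` is the pointwise infimum of the pre-fixed points
    -- above `lo`, among which `hi` is one.
    knaster-tarski : ∀ {V : Set} (F : (V → ℝ) → V → ℝ) →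
      (∀ {p q} → (∀ v → p v ≼ q v) → ∀ v → F p v ≼ F q v) →
      (lo hi : V → ℝ) → (∀ v → lo v ≼ hi v) → (∀ v → lo v ≼ F lo v) → (∀ v → F hi v ≼ hi v) →
      ∃[ p ] (∀ v → lo v ≼ p v) × (∀ v → p v ≼ hi v) × (∀ v → F p v ≋ p v)
    knaster-tarski {V} F F-mono lo hi lo≼hi lo≼Flo Fhi≼hi = p , lo≼p , p≼hi , λ v → Fp≼p v , p≼Fp v
      where
      PreFixed : (V → ℝ) → Set
      PreFixed q = (∀ v → lo v ≼ q v) × (∀ v → F q v ≼ q v)

      Values : V → Pred ℝ 0ℓ
      Values v x = ∃[ q ] PreFixed q × q v ≡ x

      lo-lower : ∀ v x → Values v x → lo v ≼ x
      lo-lower v _ (_ , (lo≼q , _) , refl) = lo≼q v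

      module I (v : V) = Infimum (Values v) (hi v) (hi , (lo≼hi , Fhi≼hi) , refl) (lo v) (lo-lower v)

      p : V → ℝ
      p v = I.inf v

      p≼ : ∀ {q} → PreFixed q → ∀ v → p v ≼ q v
      p≼ {q} q-pre v = I.inf-≼ v (q , q-pre , refl)

      p≼hi : ∀ v → p v ≼ hi v
      p≼hi = p≼ (lo≼hi , Fhi≼hi)

      lo≼p : ∀ v → lo v ≼ p v
      lo≼p v = I.inf-greatest v (lo-lower v)

      Fp≼p : ∀ v → F p v ≼ p v
      Fp≼p v = I.inf-greatest v λ { _ (_ , q-pre@(_ , Fq≼q) , refl) →
        ≼-trans (F-mono (p≼ q-pre) v) (Fq≼q v) }

      p≼Fp : ∀ v → p v ≼ F p v
      -- By monotonicity `F p` is itself a pre-fixed point above `lo`, so the infimum lies below it.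
      p≼Fp = p≼ ((λ v → ≼-trans (lo≼Flo v) (F-mono lo≼p v)) , F-mono Fp≼p)

-- Finite enumerations.

Listing : Set → Set
Listing A = Σ[ xs ∈ List A ] (∀ a → a ∈ xs)

Fin-listing : ∀ n → Listing (Fin n)
Fin-listing n = allFin n , ∈-allFin

T-listing : ∀ b → Listing (T b)
T-listing true  = tt ∷ [] , λ _ → here refl
T-listing false = [] , λ ()

Σ-listing : ∀ {A : Set} {B : A → Set} → Listing A → (∀ a → Listing (B a)) → Listing (Σ[ a ∈ A ] B a)
Σ-listing {A} {B} (xs , complete) listB =
  concatMap fibre xs , λ (a , b) → ∈-concatMap⁺ fibre
    (Any.map (λ { refl → ∈-map⁺ (a ,_) (proj₂ (listB a) b) }) (complete a))
  where
  fibre : A → List (Σ[ a ∈ A ] B a)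
  fibre a = map (a ,_) (proj₁ (listB a))

-- Extremal choices over finite sets.

module Graphs (em : ExcludedMiddle 0ℓ) where
  open Classical em

  abstract
    -- Stated for a preorder, with maximality read as "whatever lies above also lies below", so that
    -- it serves both the order of reals and reachability in a graph.
    maximal : ∀ {A : Set} → Listing A → (R : A → A → Set) → (∀ {a} → R a a) →
      (∀ {a b c} → R a b → R b c → R a c) → (P : A → Set) → ∀ a → P a →
      ∃[ m ] P m × R a m × (∀ t → P t → R m t → R t m)
    maximal {A} (xs , complete) R R-refl R-trans P a Pa =
      let m , Pm , Ram , max = go xs in m , Pm , Ram , λ t → max (complete t)
      where
      go : ∀ xs → ∃[ m ] P m × R a m × (∀ {t} → t ∈ xs → P t → R m t → R t m)
      go []       = a , Pa , R-refl , λ ()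
      go (x ∷ xs) with m , Pm , Ram , max ← go xs with em {P x × R m x}
      ... | yes (Px , Rmx) = x , Px , R-trans Ram Rmx , λ
              { (here refl) _ _    → R-refl
              ; (there t∈)  Pt Rxt → R-trans (max t∈ Pt (R-trans Rmx Rxt)) Rmx }
      ... | no ¬above = m , Pm , Ram , λ
              { (here refl) Px Rmx → contradiction (Px , Rmx) ¬above
              ; (there t∈)         → max t∈ }

  abstract
    argmax : ∀ {A : Set} → Listing A → (f : A → ℝ) (P : A → Set) → ∀ a → P a →
      ∃[ m ] P m × (∀ t → P t → f t ≼ f m)
    argmax list f P a Pa with m , Pm , _ , max ← maximal list (λ a b → f a ≼ f b) ≼-refl ≼-trans P a Pa =
      m , Pm , λ t Pt → case t Pt (≼-total (f t) (f m))
      where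
      case : ∀ t → P t → f t ≼ f m ⊎ f m ≼ f t → f t ≼ f m
      case t Pt (inj₁ ft≼fm) = ft≼fm
      case t Pt (inj₂ fm≼ft) = max t Pt fm≼ft

  abstract
    -- The smallest of finitely many positive tolerances works for all elements, since `P` is
    -- inherited by smaller tolerances.
    uniform : ∀ {A : Set} → Listing A → (P : A → ℝ → Set) → (∀ a {δ η} → δ ≼ η → P a η → P a δ) →
      (∀ a → ∃[ δ ] 0ℝ ≺ δ × P a δ) → ∃[ δ ] 0ℝ ≺ δ × (∀ a → P a δ)
    uniform {A} (xs , complete) P P-down each =
      let δ , 0≺δ , all = go xs in δ , 0≺δ , λ a → all (complete a)
      where
      go : ∀ xs → ∃[ δ ] 0ℝ ≺ δ × (∀ {a} → a ∈ xs → P a δ)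
      go []       = const 1ℚ , const-positive (ℚₚ.positive⁻¹ 1ℚ) , λ ()
      go (x ∷ xs) with δ , 0≺δ , all ← go xs | η , 0≺η , Pη ← each x with ≼-total δ η
      ... | inj₁ δ≼η = δ , 0≺δ , λ { (here refl) → P-down x δ≼η Pη ; (there a∈) → all a∈ }
      ... | inj₂ η≼δ = η , 0≺η , λ { (here refl) → Pη ; (there a∈) → P-down _ η≼δ (all a∈) }

  -- Balanced weights, potentials and classes of maximal edges.

  module Weights (V : Set) (V-listing : Listing V)
                 (E : V → V → Set) (E-listing : ∀ u v → Listing (E u v)) where

    Weight : Set
    Weight = ∀ u v → E u v → ℝ

    IsMaxIn IsMaxOut : Weight → ∀ {u v} → E u v → Set
    IsMaxIn  b {u} {v} e = ∀ x (e′ : E x v) → b x v e′ ≼ b u v e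
    IsMaxOut b {u} {v} e = ∀ y (e′ : E u y) → b u y e′ ≼ b u v e

    -- The form of balance that is convenient to use: it compares edges attaining the maxima.
    -- `BalancedAt` is the form convenient to establish, with the common maximum as a witness.
    EdgeBalanced : Weight → Set
    EdgeBalanced b = ∀ {u v w} (e : E u v) (e′ : E v w) → IsMaxIn b e → IsMaxOut b e′ → b u v e ≋ b v w e′

    EdgeBalanced-cong : ∀ {b c} → (∀ {u v} e → b u v e ≋ c u v e) → EdgeBalanced b → EdgeBalanced c
    EdgeBalanced-cong b≋c bal e e′ in-e out-e′ = ≋-trans (≋-sym (b≋c e)) (≋-trans
      (bal e e′ (λ x f → ≼-trans (proj₁ (b≋c f)) (≼-trans (in-e x f) (proj₂ (b≋c e))))
                (λ y f → ≼-trans (proj₁ (b≋c f)) (≼-trans (out-e′ y f) (proj₂ (b≋c e′)))))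
      (b≋c e′))

    BalancedAt : Weight → V → Set
    BalancedAt b v = ∃[ m ]
      (∃[ u ] Σ[ e ∈ E u v ] b u v e ≋ m) × (∀ u (e : E u v) → b u v e ≼ m) ×
      (∃[ w ] Σ[ e ∈ E v w ] b v w e ≋ m) × (∀ w (e : E v w) → b v w e ≼ m)

    shift : (V → ℝ) → Weight → Weight
    shift p b u v e = b u v e + (p u - p v)

    abstract
      maxIn : (b : Weight) → ∀ {v} → ∃[ u ] E u v → ∃[ u ] Σ[ e ∈ E u v ] IsMaxIn b e
      maxIn b {v} e₀ =
        let (u , e) , _ , max = argmax (Σ-listing V-listing λ u → E-listing u v)
                                  (λ (u , e) → b u v e) (λ _ → ⊤) e₀ tt
        in u , e , λ x e′ → max (x , e′) tt

    abstract
      maxOut : (b : Weight) → ∀ {v} → ∃[ w ] E v w → ∃[ w ] Σ[ e ∈ E v w ] IsMaxOut b e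
      maxOut b {v} e₀ =
        let (w , e) , _ , max = argmax (Σ-listing V-listing λ w → E-listing v w)
                                  (λ (w , e) → b v w e) (λ _ → ⊤) e₀ tt
        in w , e , λ y e′ → max (y , e′) tt

    module _ (has-in : ∀ v → ∃[ u ] E u v) (has-out : ∀ v → ∃[ w ] E v w) where

      module _ (b : Weight) (p : V → ℝ) (bal : EdgeBalanced (shift p b))
               (w M : ℝ) (light-in : ∀ {u v} (e : E u v) → M ≼ p v → b u v e ≼ w) where

        -- Otherwise take such an edge with p u maximal: balance at u yields an edge x → u of shifted
        -- weight above w, and as its own weight is at most w, p x exceeds p u.
        high-out-light : ∀ {u v} (e : E u v) → M ≼ p u → shift p b u v e ≼ w
        high-out-light {u₀} {v₀} e₀ M≼pu₀ = by-contradiction λ w≺e₀ →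
          let u , (M≼pu , v , e , w≺e) , max = argmax V-listing p
                (λ u → M ≼ p u × ∃[ v ] Σ[ e ∈ E u v ] w ≺ shift p b u v e) u₀ (M≼pu₀ , v₀ , e₀ , w≺e₀)
              x , e₁ , max-e₁ = maxIn (shift p b) (has-in u)
              y , e₂ , max-e₂ = maxOut (shift p b) (has-out u)
              w≺e₁ = λ e₁≼w → w≺e (≼-trans (max-e₂ v e) (≼-trans (proj₂ (bal e₁ e₂ max-e₁ max-e₂)) e₁≼w))
              px⋠pu = λ px≼pu → w≺e₁ (linear-≼ (+-mono-≼ (light-in e₁ M≼pu) px≼pu) λ n →
                solve 4 (λ b w px pu → b :+ px :+ w := w :+ pu :+ (b :+ (px :- pu))) refl
                  (seq (b x u e₁) n) (seq w n) (seq (p x) n) (seq (p u) n))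
          in px⋠pu (max x (≼-trans M≼pu (≺⇒≼ px⋠pu) , u , e₁ , w≺e₁))

        -- An edge of weight at least `w` whose shifted weight is at most `w` has `p u - p v` at
        -- most 0.
        heavy-step : ∀ {u v} (e : E u v) → w ≼ b u v e → M ≼ p u → M ≼ p v
        heavy-step {u} {v} e w≼e M≼pu = ≼-trans M≼pu
          (linear-≼ (+-mono-≼ w≼e (high-out-light e M≼pu)) λ n →
            solve 4 (λ b w pu pv → w :+ (b :+ (pu :- pv)) :+ pv := b :+ w :+ pu) refl
              (seq (b u v e) n) (seq w n) (seq (p u) n) (seq (p v) n))

      module _ (b : Weight) (bal : EdgeBalanced b) where

        -- Defined through outgoing edges; by balance it also bounds the incoming ones (`in≼top`).
        top : V → ℝ
        top v = let y , e , _ = maxOut b (has-out v) in b v y e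

        out≼top : ∀ {u v} (e : E u v) → b u v e ≼ top u
        out≼top {u} e = proj₂ (proj₂ (maxOut b (has-out u))) _ e

        in≼top : ∀ {u v} (e : E u v) → b u v e ≼ top v
        in≼top {u} {v} e =
          let x , e₁ , max-e₁ = maxIn b (has-in v)
              y , e₂ , max-e₂ = maxOut b (has-out v)
          in ≼-trans (max-e₁ u e) (proj₁ (bal e₁ e₂ max-e₁ max-e₂))

        TopEdge : V → V → Set
        TopEdge u v = Σ[ e ∈ E u v ] top u ≼ b u v e

        top-mono : ∀ {u v} → Star TopEdge u v → top u ≼ top v
        top-mono ε                 = ≼-refl
        top-mono ((e , top≼e) ◅ s) = ≼-trans top≼e (≼-trans (in≼top e) (top-mono s))

        -- The value `top` never decreases along top edges, so a walk that starts at level `w` never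
        -- uses a lighter edge.
        heavy : ∀ {w u v} → w ≼ top u → Star TopEdge u v → Star (λ x y → Σ[ e ∈ E x y ] w ≼ b x y e) u v
        heavy w≼top ε                 = ε
        heavy w≼top ((e , top≼e) ◅ s) =
          (e , ≼-trans w≼top top≼e) ◅ heavy (≼-trans w≼top (≼-trans top≼e (in≼top e))) s

        -- No walk of top edges leaves the class of `s` for good: every vertex reached can return.
        Terminal : V → Set
        Terminal s = ∀ t → Star TopEdge s t → Star TopEdge t s

        abstract
          terminal : ∀ u → ∃[ s ] Star TopEdge u s × Terminal s
          terminal u =
            let s , _ , u→s , max = maximal V-listing (Star TopEdge) ε _◅◅_ (λ _ → ⊤) u tt
            in s , u→s , λ t → max t tt

        Gap : ℝ → Set
        Gap η = ∀ u v (e : E u v) → b u v e ≺ top u → b u v e + η ≼ top u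

        Gap-down : ∀ {δ η} → δ ≼ η → Gap η → Gap δ
        Gap-down δ≼η gap-η u v e e≺top = ≼-trans (+-mono-≼ (≼-refl {b u v e}) δ≼η) (gap-η u v e e≺top)

        abstract
          gap : ∃[ η ] 0ℝ ≺ η × Gap η
          gap =
            let η , 0≺η , all = uniform
                  (Σ-listing V-listing λ u → Σ-listing V-listing λ v → E-listing u v)
                  (λ (u , v , e) η → b u v e ≺ top u → b u v e + η ≼ top u)
                  (λ (u , v , e) δ≼η h e≺ → ≼-trans (+-mono-≼ (≼-refl {b u v e}) δ≼η) (h e≺))
                  (λ (u , v , e) → each u v e (em {top u ≼ b u v e}))
            in η , 0≺η , λ u v e → all (u , v , e)
            where
            each : ∀ u v (e : E u v) → Dec (top u ≼ b u v e) →
              ∃[ η ] 0ℝ ≺ η × (b u v e ≺ top u → b u v e + η ≼ top u)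
            each u v e (yes top≼e) = const 1ℚ , const-positive (ℚₚ.positive⁻¹ 1ℚ) ,
              λ e≺top → contradiction top≼e e≺top
            -- The shortfall of the edge itself serves as its tolerance.
            each u v e (no top⋠e) = top u - b u v e ,
              (λ le → top⋠e (linear-≼ le λ n →
                solve 2 (λ t b → t :- b :+ b := con 0ℚ :+ t) refl (seq (top u) n) (seq (b u v e) n))) ,
              λ _ → linear-≼ (≼-refl {0ℝ}) λ n →
                solve 2 (λ t b → con 0ℚ :+ t := con 0ℚ :+ (b :+ (t :- b))) refl (seq (top u) n) (seq (b u v e) n)

        -- Every vertex of the class of s keeps top edges from and to the class; raising p by η on it
        -- can only lower the other edges into it, and the other edges out of it lie η below the top.
        balancedAt-terminal : ∀ {s} → Terminal s → ∀ η → Gap η →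
          (p : V → ℝ) → (∀ v → 0ℝ ≼ p v) → (∀ v → p v ≼ η) → (∀ v → Star TopEdge s v → p v ≋ η) →
          ∀ v → Star TopEdge s v → BalancedAt (shift p b) v
        balancedAt-terminal {s} term η gap-η p 0≼p p≼η p≋η v s→v =
          let y , e , _ = maxOut b (has-out v)
              s→y = s→v ◅◅ (e , ≼-refl) ◅ ε
              -- The closed walk `v → y → ⋯ → s → ⋯ → v` ends with a top edge into `v` whose source
              -- lies in the class.
              x , (e′ , topx≼e′) , s→x = last-edge s→v (e , ≼-refl) (term y s→y ◅◅ s→v)
              -- `v` returns to `s` and `s` reaches `x`, so `top v ≼ top s ≼ top x`, which is at
              -- most the weight of this edge.
              e′≋top = in≼top e′ , ≼-trans (≼-trans (top-mono (term v s→v)) (top-mono s→x)) topx≼e′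
          in top v ,
             (x , e′ , ≋-trans (unshifted e′ (≋-trans (p≋η x s→x) (≋-sym (p≋η v s→v)))) e′≋top) ,
             (λ u f → linear-≼ (+-mono-≼ (in≼top f) (≼-trans (p≼η u) (proj₂ (p≋η v s→v)))) λ n →
               solve 4 (λ b t pu pv → b :+ pu :+ t := t :+ pv :+ (b :+ (pu :- pv))) refl
                 (seq (b u v f) n) (seq (top v) n) (seq (p u) n) (seq (p v) n)) ,
             (y , e , unshifted e (≋-trans (p≋η v s→v) (≋-sym (p≋η y s→y)))) ,
             λ z f → out-bound z f (em {top v ≼ b v z f})
          where
          unshifted : ∀ {u v} (e : E u v) → p u ≋ p v → shift p b u v e ≋ b u v e
          unshifted {u} {v} e pu≋pv = linear-≋ pu≋pv λ n →
            solve 3 (λ b pu pv → pu :+ b := pv :+ (b :+ (pu :- pv))) refl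
              (seq (b u v e) n) (seq (p u) n) (seq (p v) n)

          last-edge : ∀ {u y z} → Star TopEdge s u → TopEdge u y → Star TopEdge y z →
            ∃[ x ] TopEdge x z × Star TopEdge s x
          last-edge {u} s→u e ε        = u , e , s→u
          last-edge     s→u e (e′ ◅ w) = last-edge (s→u ◅◅ e ◅ ε) e′ w

          out-bound : ∀ z (f : E v z) → Dec (top v ≼ b v z f) → shift p b v z f ≼ top v
          out-bound z f (yes top≼f) = ≼-trans
            (proj₁ (unshifted f (≋-trans (p≋η v s→v) (≋-sym (p≋η z (s→v ◅◅ (f , top≼f) ◅ ε))))))
            (out≼top f)
          out-bound z f (no top⋠f) =
            linear-≼ (+-mono-≼ (gap-η v z f top⋠f) (+-mono-≼ (p≼η v) (0≼p z))) λ n →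
              solve 5 (λ b η t pv pz → b :+ η :+ (pv :+ con 0ℚ) :+ t := t :+ (η :+ pz) :+ (b :+ (pv :- pz))) refl
                (seq (b v z f) n) (seq η n) (seq (top v) n) (seq (p v) n) (seq (p z) n)

  -- Strongly connected threshold graphs force a constant potential.

  module Thresholds (V : Set) (V-listing : Listing V)
                    (E : V → V → Set) (E-listing : ∀ u v → Listing (E u v))
                    (has-in : ∀ v → ∃[ u ] E u v) (has-out : ∀ v → ∃[ w ] E v w) where

    open Weights V V-listing E E-listing
    -- The same theory on the reversed graph: it yields the dual facts about minimisers and initial
    -- classes.
    module Op = Weights V V-listing (λ u v → E v u) (λ u v → E-listing v u)

    Heavy : Weight → ℝ → V → V → Set
    Heavy b w u v = Σ[ e ∈ E u v ] w ≼ b u v e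

    Touched : Weight → ℝ → V → Set
    Touched b w v = (∃[ u ] Heavy b w u v) ⊎ (∃[ u ] Heavy b w v u)

    op : Weight → Op.Weight
    op b u v e = b v u e

    op-balanced : ∀ {b} → EdgeBalanced b → Op.EdgeBalanced (op b)
    op-balanced bal e e′ in-e out-e′ = ≋-sym (bal e′ e out-e′ in-e)

    module _ (b : Weight) (p : V → ℝ) (bal : EdgeBalanced (shift p b))
             (connected : ∀ w u v → Touched b w u → Touched b w v → Star (Heavy b w) u v) where

      -- One inequality suffices for constancy, as `u` and `v` may be exchanged.
      Flat : ℝ → Set
      Flat w = ∀ u v → Touched b w u → Touched b w v → p u ≼ p v

      -p : V → ℝ
      -p v = - p v

      -- Reversing an edge swaps its ends in `p u - p v`, which negating the potential undoes.
      -p-balanced : Op.EdgeBalanced (Op.shift -p (op b))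
      -p-balanced = Op.EdgeBalanced-cong {op (shift p b)} {Op.shift -p (op b)}
        (λ {u} {v} e → pointwise-≋ λ n →
          solve 3 (λ b pu pv → b :+ (pv :- pu) := b :+ (:- pu :- (:- pv))) refl
            (seq (b v u e) n) (seq (p u) n) (seq (p v) n))
        (op-balanced {shift p b} bal)

      -p-cancel : ∀ u v → -p v ≼ -p u → p u ≼ p v
      -p-cancel u v -pv≼-pu = linear-≼ -pv≼-pu λ n →
        solve 2 (λ pu pv → :- pv :+ pv := :- pu :+ pu) refl (seq (p u) n) (seq (p v) n)

      climb : ∀ w M → (∀ {u v} (e : E u v) → M ≼ p v → b u v e ≼ w) →
        ∀ {u v} → Star (Heavy b w) u v → M ≼ p u → M ≼ p v
      climb w M light ε                M≼pu = M≼pu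
      climb w M light ((e , w≼e) ◅ es) M≼pu =
        climb w M light es (heavy-step has-in has-out b p bal w M light e w≼e M≼pu)

      -- The dual of `climb`: small values of `p` propagate backwards along heavy edges.
      descend : ∀ w M → (∀ {u v} (e : E v u) → M ≼ -p v → b v u e ≼ w) →
        ∀ {u v} → Star (Heavy b w) u v → M ≼ -p v → M ≼ -p u
      descend w M light ε                M≼-pv = M≼-pv
      descend w M light ((e , w≼e) ◅ es) M≼-pv =
        Op.heavy-step has-out has-in (op b) -p -p-balanced w M light e w≼e (descend w M light es M≼-pv)

      -- Both vertices lie in the threshold graph at the smaller of the two weights, which still
      -- exceeds `w`.
      flat-compare : ∀ w → (∀ {x y} (f : E x y) → w ≺ b x y f → Flat (b x y f)) →
        ∀ {x₁ y₁ y₂ x₂} (f₁ : E x₁ y₁) (f₂ : E y₂ x₂) → w ≺ b x₁ y₁ f₁ → w ≺ b y₂ x₂ f₂ → p y₁ ≼ p y₂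
      flat-compare w flat-above {x₁} {y₁} {y₂} {x₂} f₁ f₂ w≺f₁ w≺f₂ =
        [ (λ f₁≼f₂ → flat-above f₁ w≺f₁ y₁ y₂ (inj₁ (x₁ , f₁ , ≼-refl)) (inj₂ (x₂ , f₂ , f₁≼f₂)))
        , (λ f₂≼f₁ → flat-above f₂ w≺f₂ y₁ y₂ (inj₁ (x₁ , f₁ , f₂≼f₁)) (inj₂ (x₂ , f₂ , ≼-refl)))
        ]′ (≼-total (b x₁ y₁ f₁) (b y₂ x₂ f₂))

      -- The endpoints of edges heavier than w all have the same value of p, so they miss all maximisers
      -- or all minimisers of p on the threshold graph; from there p propagates along its edges.
      flat-step : ∀ w s t → Touched b w s → Touched b w t →
        (∀ v → Touched b w v → p v ≼ p s) → (∀ v → Touched b w v → p t ≼ p v) →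
        (∀ {x y} (f : E x y) → w ≺ b x y f → Flat (b x y f)) → Flat w
      flat-step w s t s∈ t∈ s-max t-min flat-above x y x∈ y∈ = by-contradiction λ px⋠py →
        let light-at-max : ∀ {x₁ y₁} (f : E x₁ y₁) → p s ≼ p y₁ → b x₁ y₁ f ≼ w
            light-at-max {x₁} {y₁} f₁ ps≼py₁ = by-contradiction λ w≺f₁ →
              -- Some heavier edge enters a maximiser here. By `flat-compare` none can then leave a
              -- minimiser, so the argument runs backwards from the minimisers.
              let light-at-min : ∀ {x₂ y₂} (f : E y₂ x₂) → -p t ≼ -p y₂ → b y₂ x₂ f ≼ w
                  light-at-min {x₂} {y₂} f₂ -pt≼-py₂ = by-contradiction λ w≺f₂ →
                    px⋠py (≼-trans (s-max x x∈) (≼-trans ps≼py₁ (≼-trans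
                      (flat-compare w flat-above f₁ f₂ w≺f₁ w≺f₂)
                      (≼-trans (-p-cancel y₂ t -pt≼-py₂) (t-min y y∈)))))
              in px⋠py (≼-trans
                   (-p-cancel x t (descend w (-p t) light-at-min (connected w x t x∈ t∈) ≼-refl))
                   (t-min y y∈))
        in px⋠py (≼-trans (s-max x x∈) (climb w (p s) light-at-max (connected w s y s∈ y∈) ≼-refl))

      -- Among the edges whose level is not flat take a heaviest one; every heavier level is flat,
      -- so `flat-step` applies to it.
      flat : ∀ {u v} (e : E u v) → Flat (b u v e)
      flat {u₀} {v₀} e₀ = by-contradiction λ ¬flat₀ →
        let (u , v , e) , ¬flat , max = argmax
              (Σ-listing V-listing λ u → Σ-listing V-listing λ v → E-listing u v)
              (λ (u , v , e) → b u v e) (λ (u , v , e) → ¬ Flat (b u v e)) (u₀ , v₀ , e₀) ¬flat₀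
            s , s∈ , s-max = argmax V-listing p (Touched b (b u v e)) u (inj₂ (v , e , ≼-refl))
            t , t∈ , t-max = argmax V-listing -p (Touched b (b u v e)) u (inj₂ (v , e , ≼-refl))
        in ¬flat (flat-step (b u v e) s t s∈ t∈ s-max (λ v v∈ → -p-cancel t v (t-max v v∈))
             (λ {x} {y} f w≺f → by-contradiction λ ¬flat-f → w≺f (max (x , y , f) ¬flat-f)))

      potential-constant : ∀ {u v} (e : E u v) → p u ≋ p v
      potential-constant {u} {v} e =
        flat e u v (inj₂ (v , e , ≼-refl)) (inj₁ (u , e , ≼-refl)) ,
        flat e v u (inj₁ (u , e , ≼-refl)) (inj₂ (v , e , ≼-refl))

    -- Prescribing a potential on two classes and balancing elsewhere.

    module Rebalancing (b : Weight) (bal : EdgeBalanced b) (S C : V → Set)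
                       (disjoint : ∀ v → S v → ¬ C v) (η : ℝ) (0≼η : 0ℝ ≼ η) where

      -- Balance of the shifted weight at v reads p v = (max (b u v + p u) - max (b v w - p w)) / 2,
      -- a fixed-point equation with monotone right-hand side.
      incoming outgoing : (V → ℝ) → Weight
      incoming q u v e = b u v e + q u
      outgoing q u v e = b u v e - q v

      bestIn bestOut : (V → ℝ) → V → ℝ
      bestIn  q v = let u , e , _ = maxIn  (incoming q) (has-in v)  in incoming q u v e
      bestOut q v = let w , e , _ = maxOut (outgoing q) (has-out v) in outgoing q v w e

      ≼bestIn : ∀ q {u v} (e : E u v) → incoming q u v e ≼ bestIn q v
      ≼bestIn q {v = v} e = proj₂ (proj₂ (maxIn (incoming q) (has-in v))) _ e

      ≼bestOut : ∀ q {u v} (e : E u v) → outgoing q u v e ≼ bestOut q u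
      ≼bestOut q {u} e = proj₂ (proj₂ (maxOut (outgoing q) (has-out u))) _ e

      abstract
        mean : (V → ℝ) → V → ℝ
        mean q v = half (bestIn q v - bestOut q v)

        -- A larger potential raises the best incoming value and lowers the best outgoing one.
        mean-mono : ∀ {p q} → (∀ v → p v ≼ q v) → ∀ v → mean p v ≼ mean q v
        mean-mono {p} {q} p≼q v =
          let u , e , _  = maxIn (incoming p) (has-in v)
              w , e′ , _ = maxOut (outgoing q) (has-out v)
          in half-mono-≼ {bestIn p v - bestOut p v} {bestIn q v - bestOut q v} (linear-≼
               (+-mono-≼ (+-mono-≼ (p≼q u) (≼bestIn q e)) (+-mono-≼ (p≼q w) (≼bestOut p e′))) λ n →
                 solve 8 (λ b b′ pu qu pw qw I O →
                     pu :+ (b :+ qu) :+ (pw :+ (b′ :- pw)) :+ (I :- (b′ :- qw))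
                       := qu :+ I :+ (qw :+ O) :+ (b :+ pu :- O)) refl
                   (seq (b u v e) n) (seq (b v w e′) n) (seq (p u) n) (seq (q u) n)
                   (seq (p w) n) (seq (q w) n) (seq (bestIn q v) n) (seq (bestOut p v) n))

        -- For a constant potential the two best values are the balanced maxima plus and minus `c`.
        -- This makes the constants 0 and `η` bounds for the fixed point.
        mean-const : ∀ c v → mean (λ _ → c) v ≋ c
        mean-const c v =
          let u , e , max-e   = maxIn (incoming (λ _ → c)) (has-in v)
              w , e′ , max-e′ = maxOut (outgoing (λ _ → c)) (has-out v)
              e≋e′ = bal e e′
                (λ x f → linear-≼ (max-e x f) λ n →
                  solve 3 (λ f e c → f :+ c :+ e := e :+ c :+ f) refl (seq (b x v f) n) (seq (b u v e) n) (seq c n))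
                (λ y f → linear-≼ (max-e′ y f) λ n →
                  solve 3 (λ f e c → f :- c :+ e := e :- c :+ f) refl (seq (b v y f) n) (seq (b v w e′) n) (seq c n))
              identity = λ n → solve 3 (λ e e′ c → con ½ :* e :+ c := con ½ :* e′ :+ con ½ :* (e :+ c :- (e′ :- c)))
                refl (seq (b u v e) n) (seq (b v w e′) n) (seq c n)
          in linear-≋ (half-mono-≼ {b u v e} {b v w e′} (proj₁ e≋e′) , half-mono-≼ (proj₂ e≋e′)) identity

        mean-double : ∀ q v → mean q v + mean q v ≋ bestIn q v - bestOut q v
        mean-double q v = pointwise-≋ λ n →
          solve 1 (λ x → con ½ :* x :+ con ½ :* x := x) refl (seq (bestIn q v - bestOut q v) n)

      -- The decisions are arguments, so that facts about `F` follow by cases on them.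
      prescribe : ∀ {P Q : Set} → Dec P → Dec Q → ℝ → ℝ
      prescribe (yes _) _       x = η
      prescribe (no _)  (yes _) x = 0ℝ
      prescribe (no _)  (no _)  x = x

      F : (V → ℝ) → V → ℝ
      F q v = prescribe (em {S v}) (em {C v}) (mean q v)

      prescribe-mono : ∀ {P Q : Set} (P? : Dec P) (Q? : Dec Q) {x y} → x ≼ y → prescribe P? Q? x ≼ prescribe P? Q? y
      prescribe-mono (yes _) _       x≼y = ≼-refl
      prescribe-mono (no _)  (yes _) x≼y = ≼-refl
      prescribe-mono (no _)  (no _)  x≼y = x≼y

      prescribe-≽0 : ∀ {P Q : Set} (P? : Dec P) (Q? : Dec Q) {x} → 0ℝ ≼ x → 0ℝ ≼ prescribe P? Q? x
      prescribe-≽0 (yes _) _       0≼x = 0≼η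
      prescribe-≽0 (no _)  (yes _) 0≼x = ≼-refl
      prescribe-≽0 (no _)  (no _)  0≼x = 0≼x

      prescribe-≼η : ∀ {P Q : Set} (P? : Dec P) (Q? : Dec Q) {x} → x ≼ η → prescribe P? Q? x ≼ η
      prescribe-≼η (yes _) _       x≼η = ≼-refl
      prescribe-≼η (no _)  (yes _) x≼η = 0≼η
      prescribe-≼η (no _)  (no _)  x≼η = x≼η

      F-mono : ∀ {p q} → (∀ v → p v ≼ q v) → ∀ v → F p v ≼ F q v
      F-mono {p} {q} p≼q v = prescribe-mono (em {S v}) (em {C v}) {mean p v} {mean q v} (mean-mono p≼q v)

      0≼F0 : ∀ v → 0ℝ ≼ F (λ _ → 0ℝ) v
      0≼F0 v = prescribe-≽0 (em {S v}) (em {C v}) {mean (λ _ → 0ℝ) v} (proj₂ (mean-const 0ℝ v))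

      Fη≼η : ∀ v → F (λ _ → η) v ≼ η
      Fη≼η v = prescribe-≼η (em {S v}) (em {C v}) {mean (λ _ → η) v} (proj₁ (mean-const η v))

      abstract
        fixed-point : ∃[ p ] (∀ v → 0ℝ ≼ p v) × (∀ v → p v ≼ η) × (∀ v → F p v ≋ p v)
        fixed-point = knaster-tarski F (λ {p} {q} → F-mono {p} {q})
          (λ _ → 0ℝ) (λ _ → η) (λ _ → 0≼η) 0≼F0 Fη≼η

      p : V → ℝ
      p = proj₁ fixed-point

      0≼p : ∀ v → 0ℝ ≼ p v
      0≼p = proj₁ (proj₂ fixed-point)

      p≼η : ∀ v → p v ≼ η
      p≼η = proj₁ (proj₂ (proj₂ fixed-point))

      Fp≋p : ∀ v → F p v ≋ p v
      Fp≋p = proj₂ (proj₂ (proj₂ fixed-point))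

      prescribe-S : ∀ {P Q : Set} (P? : Dec P) (Q? : Dec Q) {x} → P → prescribe P? Q? x ≡ η
      prescribe-S (yes _) _ _ = refl
      prescribe-S (no ¬P) _ P = contradiction P ¬P

      prescribe-C : ∀ {P Q : Set} (P? : Dec P) (Q? : Dec Q) {x} → ¬ P → Q → prescribe P? Q? x ≡ 0ℝ
      prescribe-C (yes P) _       ¬P Q = contradiction P ¬P
      prescribe-C (no _)  (yes _) _  _ = refl
      prescribe-C (no _)  (no ¬Q) _  Q = contradiction Q ¬Q

      prescribe-free : ∀ {P Q : Set} (P? : Dec P) (Q? : Dec Q) {x} → ¬ P → ¬ Q → prescribe P? Q? x ≡ x
      prescribe-free (yes P) _       ¬P _  = contradiction P ¬P
      prescribe-free (no _)  (yes Q) _  ¬Q = contradiction Q ¬Q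
      prescribe-free (no _)  (no _)  _  _  = refl

      p≋η : ∀ v → S v → p v ≋ η
      p≋η v v∈S = ≋-sym (subst (_≋ p v) (prescribe-S (em {S v}) (em {C v}) {mean p v} v∈S) (Fp≋p v))

      p≋0 : ∀ v → C v → p v ≋ 0ℝ
      p≋0 v v∈C = ≋-sym
        (subst (_≋ p v) (prescribe-C (em {S v}) (em {C v}) {mean p v} (λ v∈S → disjoint v v∈S v∈C) v∈C) (Fp≋p v))

      mean≋p : ∀ v → ¬ S v → ¬ C v → mean p v ≋ p v
      mean≋p v v∉S v∉C = subst (_≋ p v) (prescribe-free (em {S v}) (em {C v}) {mean p v} v∉S v∉C) (Fp≋p v)

      -- The fixed-point equation rearranges to `bestIn - p v = bestOut + p v`, and these are the
      -- maximal shifted weights into and out of `v`.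
      balancedAt-mean : ∀ v → mean p v ≋ p v → BalancedAt (shift p b) v
      balancedAt-mean v mean≋p =
        let u , e , _ = maxIn (incoming p) (has-in v)
            w , e′ , _ = maxOut (outgoing p) (has-out v)
            m≋ : bestIn p v - p v ≋ bestOut p v + p v
            m≋ = linear-≋ (≋-trans (≋-sym (mean-double p v)) (+-cong mean≋p mean≋p)) λ n →
              solve 3 (λ I O pv → I :- O :+ (O :+ pv) := pv :+ pv :+ (I :- pv)) refl
                (seq (bestIn p v) n) (seq (bestOut p v) n) (seq (p v) n)
        in bestIn p v - p v ,
           (u , e , pointwise-≋ λ n → in-identity (seq (b u v e) n) (seq (p u) n) (seq (p v) n)) ,
           (λ x f → linear-≼ (≼bestIn p f) λ n →
             solve 4 (λ f px pv I → f :+ px :+ (I :- pv) := I :+ (f :+ (px :- pv))) refl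
               (seq (b x v f) n) (seq (p x) n) (seq (p v) n) (seq (bestIn p v) n)) ,
           (w , e′ , ≋-trans
             (pointwise-≋ λ n → out-identity (seq (b v w e′) n) (seq (p v) n) (seq (p w) n)) (≋-sym m≋)) ,
           (λ y f → ≼-trans (linear-≼ (≼bestOut p f) λ n →
             solve 4 (λ f py pv O → f :- py :+ (O :+ pv) := O :+ (f :+ (pv :- py))) refl
               (seq (b v y f) n) (seq (p y) n) (seq (p v) n) (seq (bestOut p v) n)) (proj₂ m≋))
        where
        in-identity : ∀ e pu pv → e ℚ.+ (pu ℚ.- pv) ≡ e ℚ.+ pu ℚ.- pv
        in-identity = solve 3 (λ e pu pv → e :+ (pu :- pv) := e :+ pu :- pv) refl
        out-identity : ∀ e pv pw → e ℚ.+ (pv ℚ.- pw) ≡ e ℚ.- pw ℚ.+ pv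
        out-identity = solve 3 (λ e pv pw → e :+ (pv :- pw) := e :- pw :+ pv) refl

    -- A nonconstant balancing potential from a missing heavy walk.

    module _ (b : Weight) (bal : EdgeBalanced b) where

      op-bal : Op.EdgeBalanced (op b)
      op-bal = op-balanced {b} bal

      abstract
        common-gap : ∃[ η ] 0ℝ ≺ η × Gap has-in has-out b bal η × Op.Gap has-out has-in (op b) op-bal η
        common-gap =
          let δ , 0≺δ , gap-δ = gap has-in has-out b bal
              η , 0≺η , gap-η = Op.gap has-out has-in (op b) op-bal
          in [ (λ δ≼η → δ , 0≺δ , gap-δ , Op.Gap-down has-out has-in (op b) op-bal δ≼η gap-η)
             , (λ η≼δ → η , 0≺η , Gap-down has-in has-out b bal η≼δ gap-δ , gap-η)
             ]′ (≼-total δ η)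

      rebalance : ∀ w u v → Touched b w u → Touched b w v → ¬ Star (Heavy b w) u v →
        ∃[ p ] (∀ x → BalancedAt (shift p b) x) × ∃[ s ] ∃[ c ] p c ≺ p s
      rebalance w u v u∈ v∈ ¬u→v =
        Re.p , balanced , s , c ,
        λ ps≼pc → 0≺η (≼-trans (proj₂ (Re.p≋η s ε)) (≼-trans ps≼pc (proj₁ (Re.p≋0 c ε))))
        where
        s = proj₁ (terminal has-in has-out b bal u)
        u→s = proj₁ (proj₂ (terminal has-in has-out b bal u))
        s-terminal = proj₂ (proj₂ (terminal has-in has-out b bal u))
        c = proj₁ (Op.terminal has-out has-in (op b) op-bal v)
        v→c = proj₁ (proj₂ (Op.terminal has-out has-in (op b) op-bal v))
        c-terminal = proj₂ (proj₂ (Op.terminal has-out has-in (op b) op-bal v))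

        S C : V → Set
        S = Star (TopEdge has-in has-out b bal) s
        C = Star (Op.TopEdge has-out has-in (op b) op-bal) c

        w≼top : Touched b w u → w ≼ top has-in has-out b bal u
        w≼top (inj₁ (_ , e , w≼e)) = ≼-trans w≼e (in≼top has-in has-out b bal e)
        w≼top (inj₂ (_ , e , w≼e)) = ≼-trans w≼e (out≼top has-in has-out b bal e)

        w≼top-op : Touched b w v → w ≼ Op.top has-out has-in (op b) op-bal v
        w≼top-op (inj₁ (_ , e , w≼e)) = ≼-trans w≼e (Op.out≼top has-out has-in (op b) op-bal e)
        w≼top-op (inj₂ (_ , e , w≼e)) = ≼-trans w≼e (Op.in≼top has-out has-in (op b) op-bal e)

        disjoint : ∀ x → S x → ¬ C x
        -- A common vertex `x` would join `u → s → x` to the reversal of `v → c → x`, a heavy walk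
        -- from `u` to `v`.
        disjoint x s→x c→x = ¬u→v
          (heavy has-in has-out b bal (w≼top u∈) (u→s ◅◅ s→x) ◅◅
           Star.reverse id (Op.heavy has-out has-in (op b) op-bal (w≼top-op v∈) (v→c ◅◅ c→x)))

        η = proj₁ common-gap
        0≺η = proj₁ (proj₂ common-gap)

        module Re = Rebalancing b bal S C disjoint η (≺⇒≼ 0≺η)

        -- On the reversed graph this potential plays the part of `Re.p`: it stays between 0 and `η`
        -- and equals `η` on `C`, so the result on terminal classes applies there.
        p′ : V → ℝ
        p′ x = η - Re.p x

        op-balancedAt : ∀ x → Op.BalancedAt (Op.shift p′ (op b)) x → BalancedAt (shift Re.p b) x
        op-balancedAt x (m , (y , e , e≋m) , ins , (z , f , f≋m) , outs) =
          m , (z , f , ≋-trans (flipped f) f≋m) , (λ z f → ≼-trans (proj₁ (flipped f)) (outs z f)) ,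
              (y , e , ≋-trans (flipped e) e≋m) , (λ y e → ≼-trans (proj₁ (flipped e)) (ins y e))
          where
          flipped : ∀ {x y} (e : E x y) → shift Re.p b x y e ≋ Op.shift p′ (op b) y x e
          flipped {x} {y} e = pointwise-≋ λ n →
            solve 4 (λ e η px py → e :+ (px :- py) := e :+ (η :- py :- (η :- px))) refl
              (seq (b x y e) n) (seq η n) (seq (Re.p x) n) (seq (Re.p y) n)

        balanced-by-cases : ∀ x → Dec (S x) → Dec (C x) → BalancedAt (shift Re.p b) x
        balanced-by-cases x (yes s→x) _ = balancedAt-terminal has-in has-out b bal s-terminal η
          (proj₁ (proj₂ (proj₂ common-gap))) Re.p Re.0≼p Re.p≼η Re.p≋η x s→x
        balanced-by-cases x (no _) (yes c→x) = op-balancedAt x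
          (Op.balancedAt-terminal has-out has-in (op b) op-bal c-terminal η
            (proj₂ (proj₂ (proj₂ common-gap))) p′
            (λ v → linear-≼ (Re.p≼η v) λ n →
              solve 2 (λ η pv → pv :+ (η :- pv) := η :+ con 0ℚ) refl (seq η n) (seq (Re.p v) n))
            (λ v → linear-≼ (Re.0≼p v) λ n →
              solve 2 (λ η pv → con 0ℚ :+ η := pv :+ (η :- pv)) refl (seq η n) (seq (Re.p v) n))
            (λ v c→v → ≋-sym (linear-≋ (Re.p≋0 v c→v) λ n →
              solve 2 (λ η pv → pv :+ (η :- pv) := con 0ℚ :+ η) refl (seq η n) (seq (Re.p v) n)))
            x c→x)
        balanced-by-cases x (no x∉S) (no x∉C) = Re.balancedAt-mean x (Re.mean≋p x x∉S x∉C)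

        balanced : ∀ x → BalancedAt (shift Re.p b) x
        balanced x = balanced-by-cases x (em {S x}) (em {C x})

  -- Walk sums, loop erasure and potentials.

  module _ (G : FiniteDigraph) where
    open FiniteDigraph G
    open DecMembership (_≟_ {size}) using (_∈?_)

    -- Unlike `sources` this includes the last vertex, so uniqueness describes a simple path.
    vertices : ∀ {u v} → Star Edge u v → List Vertex
    vertices {u} ε        = u ∷ []
    vertices {u} (_ ◅ es) = u ∷ vertices es

    sumAlong-◅◅ : ∀ f {u v w} (p : Star Edge u v) (q : Star Edge v w) →
      sumAlong G f (p ◅◅ q) ≋ sumAlong G f p + sumAlong G f q
    sumAlong-◅◅ f ε q = pointwise-≋ λ n →
      solve 1 (λ x → x := con 0ℚ :+ x) refl (seq (sumAlong G f q) n)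
    sumAlong-◅◅ f (_◅_ {u} {v} e p) q = linear-≋ (sumAlong-◅◅ f p q) λ n →
      solve 4 (λ e pq p q → pq :+ (e :+ p :+ q) := p :+ q :+ (e :+ pq)) refl
        (seq (f u v e) n) (seq (sumAlong G f (p ◅◅ q)) n) (seq (sumAlong G f p) n) (seq (sumAlong G f q) n)

    sumAlong-telescopes : ∀ f (p : Vertex → ℝ) → (∀ u v e → f u v e ≋ p v - p u) →
      ∀ {u v} (w : Star Edge u v) → sumAlong G f w ≋ p v - p u
    sumAlong-telescopes f p f≋ {u} ε = pointwise-≋ λ n →
      solve 1 (λ x → con 0ℚ := x :- x) refl (seq (p u) n)
    sumAlong-telescopes f p f≋ {u} {v} (_◅_ {u} {x} e w) =
      linear-≋ (+-cong (f≋ u x e) (sumAlong-telescopes f p f≋ w)) λ n →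
        solve 5 (λ e s pu px pv → e :+ s :+ (pv :- pu) := px :- pu :+ (pv :- px) :+ (e :+ s)) refl
          (seq (f u x e) n) (seq (sumAlong G f w) n) (seq (p u) n) (seq (p x) n) (seq (p v) n)

    -- `distinct` is what turns `before`, preceded by an edge out of `x`, into a `Cycle`;
    -- `sources-⊆` carries the freshness of a vertex through the recursion.
    record Split {u v} (x : Vertex) (w : Star Edge u v) : Set where
      field
        before     : Star Edge u x
        after      : Star Edge x v
        joined     : w ≡ before ◅◅ after
        simple     : Unique (vertices after)
        sources-⊆  : ∀ {y} → All (y ≢_) (vertices w) → All (y ≢_) (sources G before)
        distinct   : Unique (x ∷ sources G before)

    split : ∀ {u v} (x : Vertex) (w : Star Edge u v) → x ∈ vertices w → Unique (vertices w) → Split x w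
    split x ε (here refl) unique = record
      { before = ε ; after = ε ; joined = refl ; simple = unique ; sources-⊆ = λ _ → [] ; distinct = [] ∷ [] }
    split x w@(_ ◅ _) (here refl) unique = record
      { before = ε ; after = w ; joined = refl ; simple = unique ; sources-⊆ = λ _ → [] ; distinct = [] ∷ [] }
    split {u} x (e ◅ w) (there x∈w) (u∉w ∷ unique) = record
      { before    = e ◅ before
      ; after     = after
      ; joined    = cong (e ◅_) joined
      ; simple    = simple
      ; sources-⊆ = λ { (y≢u ∷ y∉w) → y≢u ∷ sources-⊆ y∉w }
      ; distinct  = extend distinct
      }
      where
      open Split (split x w x∈w unique)
      extend : Unique (x ∷ sources G before) → Unique (x ∷ u ∷ sources G before)
      extend (x∉ ∷ before-unique) =
        ((λ x≡u → All.lookup u∉w x∈w (sym x≡u)) ∷ x∉) ∷ sources-⊆ u∉w ∷ before-unique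

    module _ (d : GraphFunction G) (closed : ∀ (c : Cycle G) → sumAlong G d (Cycle.walk c) ≋ 0ℝ) where

      -- Erasing a loop removes a simple cycle, which does not change the sum.
      erase-loops : ∀ {u v} (w : Star Edge u v) →
        Σ[ s ∈ Star Edge u v ] Unique (vertices s) × sumAlong G d w ≋ sumAlong G d s
      erase-loops ε = ε , [] ∷ [] , ≋-refl
      erase-loops {u} {v} (_◅_ {u} {x} e w) = extend (erase-loops w)
        where
        extend : Σ[ s ∈ Star Edge x v ] Unique (vertices s) × sumAlong G d w ≋ sumAlong G d s →
          Σ[ s ∈ Star Edge u v ] Unique (vertices s) × d u x e + sumAlong G d w ≋ sumAlong G d s
        extend (s , s-unique , w≋s) = by-membership (u ∈? vertices s)
          where
          by-membership : Dec (u ∈ vertices s) →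
            Σ[ s ∈ Star Edge u v ] Unique (vertices s) × d u x e + sumAlong G d w ≋ sumAlong G d s
          by-membership (no u∉s) =
            e ◅ s , All.tabulate (λ y∈s u≡y → u∉s (subst (_∈ vertices s) (sym u≡y) y∈s)) ∷ s-unique ,
            +-cong (≋-refl {d u x e}) w≋s
          by-membership (yes u∈s) = after , simple ,
            linear-≋ (+-cong w≋s (+-cong s≋ (closed cycle))) λ n →
              solve 5 (λ e w s b a → w :+ (s :+ (e :+ b)) :+ a := s :+ (b :+ a :+ con 0ℚ) :+ (e :+ w)) refl
                (seq (d u x e) n) (seq (sumAlong G d w) n) (seq (sumAlong G d s) n)
                (seq (sumAlong G d before) n) (seq (sumAlong G d after) n)
            where
            open Split (split u s u∈s s-unique)
            cycle : Cycle G
            cycle = record { edge = e ; return = before ; distinct = distinct }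
            s≋ : sumAlong G d s ≋ sumAlong G d before + sumAlong G d after
            s≋ = subst (λ s → sumAlong G d s ≋ sumAlong G d before + sumAlong G d after)
                   (sym joined) (sumAlong-◅◅ d before after)

      -- Erasing loops leaves a simple path from `u` to itself, which must be empty.
      closed-walk : ∀ {u} (w : Star Edge u u) → sumAlong G d w ≋ 0ℝ
      closed-walk {u} w = trivial (erase-loops w)
        where
        end∈vertices : ∀ {u v} (s : Star Edge u v) → v ∈ vertices s
        end∈vertices ε       = here refl
        end∈vertices (_ ◅ s) = there (end∈vertices s)

        trivial : Σ[ s ∈ Star Edge u u ] Unique (vertices s) × sumAlong G d w ≋ sumAlong G d s →
          sumAlong G d w ≋ 0ℝ
        trivial (ε , _ , w≋0)              = w≋0
        trivial (_ ◅ s , (u∉s ∷ _) , _) = contradiction refl (All.lookup u∉s (end∈vertices s))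

      -- Sum along a chosen walk from the root `r`. Closing the walk to `u` followed by `e`, and the
      -- walk to `v`, by the same return walk gives two zero sums whose comparison is the claim.
      potential : StronglyConnected digraph → Vertex → ∃[ p ] (∀ u v e → d u v e ≋ p v - p u)
      potential connected r = p , λ u v e →
        let back = connected v r tt tt in
        linear-≋
          (+-cong (≋-trans (≋-sym (sumAlong-◅◅ d (to u) (e ◅ back))) (closed-walk (to u ◅◅ e ◅ back)))
            (≋-trans (≋-sym (closed-walk (to v ◅◅ back))) (sumAlong-◅◅ d (to v) back)))
          λ n → solve 4 (λ e pu pv b → pu :+ (e :+ b) :+ con 0ℚ :+ (pv :- pu) := con 0ℚ :+ (pv :+ b) :+ e) refl
            (seq (d u v e) n) (seq (p u) n) (seq (p v) n) (seq (sumAlong G d back) n)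
        where
        to : ∀ v → Star Edge r v
        to v = connected r v tt tt
        p : Vertex → ℝ
        p v = sumAlong G d (to v)

    -- Translation between the notions of balance.

    open Weights Vertex (Fin-listing size) Edge (λ u v → T-listing (adj u v))

    Balanced⇒EdgeBalanced : ∀ β → Balanced G β → EdgeBalanced β
    Balanced⇒EdgeBalanced β bal {u} {v} {w} e e′ max-e max-e′ = ≈⇒≋ (bal v (β u v e) (β v w e′)
      ((β u v e , (u , e , ≈-refl (β u v e)) , ≈-refl (β u v e)) ,
        λ x (y , f , x≈f) → unwrap (≼-trans (proj₁ (≈⇒≋ {x} {β y v f} x≈f)) (max-e y f)))
      ((β v w e′ , (w , e′ , ≈-refl (β v w e′)) , ≈-refl (β v w e′)) ,
        λ x (y , f , x≈f) → unwrap (≼-trans (proj₁ (≈⇒≋ {x} {β v y f} x≈f)) (max-e′ y f))))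

    BalancedAt⇒Balanced : ∀ β → (∀ v → BalancedAt β v) → Balanced G β
    BalancedAt⇒Balanced β balAt v i o ((x , (u , e , x≈e) , x≈i) , in≤i) ((y , (w , f , y≈f) , y≈o) , out≤o) =
      let m , (u′ , e′ , e′≋m) , in≼m , (w′ , f′ , f′≋m) , out≼m = balAt v
          x≋e = ≈⇒≋ {x} {β u v e} x≈e
          x≋i = ≈⇒≋ {x} {i} x≈i
          y≋f = ≈⇒≋ {y} {β v w f} y≈f
          y≋o = ≈⇒≋ {y} {o} y≈o
          i≋m : i ≋ m
          i≋m = ≼-trans (proj₂ x≋i) (≼-trans (proj₁ x≋e) (in≼m u e)) ,
                ≼-trans (proj₂ e′≋m) (wrap (in≤i (β u′ v e′) (u′ , e′ , ≈-refl (β u′ v e′))))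
          o≋m : o ≋ m
          o≋m = ≼-trans (proj₂ y≋o) (≼-trans (proj₁ y≋f) (out≼m w f)) ,
                ≼-trans (proj₂ f′≋m) (wrap (out≤o (β v w′ f′) (w′ , f′ , ≈-refl (β v w′ f′))))
      in ≋⇒≈ (≋-trans i≋m (≋-sym o≋m))

    -- The two implications for a strongly connected digraph.

    module _ (connected : StronglyConnected digraph) where

      -- A walk from `v` to `a` either begins with an edge out of `v` or is empty, and then the
      -- given edge leaves `v`.
      has-out : ∀ {a b} → Edge a b → ∀ v → ∃[ w ] Edge v w
      has-out {a} {b} e v = first (connected v a tt tt)
        where
        first : Star Edge v a → ∃[ w ] Edge v w
        first ε       = b , e
        first (f ◅ _) = _ , f

      has-in : ∀ {a b} → Edge a b → ∀ v → ∃[ u ] Edge u v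
      has-in {a} e v = last e (connected _ v tt tt)
        where
        last : ∀ {x y} → Edge x y → Star Edge y v → ∃[ u ] Edge u v
        last f ε       = _ , f
        last _ (f ◅ w) = last f w

      module _ (β : GraphFunction G) (β-balanced : Balanced G β) where

        -- The edge `e₀` excludes the edgeless single vertex; each implication has an edge at hand
        -- when it opens this module.
        module Th {a b} (e₀ : Edge a b) = Thresholds Vertex (Fin-listing size) Edge
          (λ u v → T-listing (adj u v)) (has-in e₀) (has-out e₀)

        unwrap-heavy : ∀ {w u v} → Σ[ e ∈ Edge u v ] w ≼ β u v e → HeavyEdge G β w u v
        unwrap-heavy (e , w≼e) = e , unwrap w≼e

        unique⇒connected : IsUniqueBalanced G β → ∀ w → StronglyConnected (threshold G β w)
        unique⇒connected (_ , unique) w u v u∈ v∈ = by-contradiction λ ¬u→v →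
          let _ , _ , e₀ = some-edge u∈
              p , balancedAt , s , c , pc≺ps = Th.rebalance e₀ β (Balanced⇒EdgeBalanced β β-balanced)
                w u v (touched u∈) (touched v∈) (λ u→v → ¬u→v (Star.map (unwrap-heavy {w}) u→v))
              γ≈β = unique (shift p β) (BalancedAt⇒Balanced (shift p β) balancedAt) (equivalent p)
          -- Uniqueness makes the shift trivial, so `p` is constant along a walk from `s` to `c`,
          -- against `p c ≺ p s`.
          in pc≺ps (proj₁ (constant p γ≈β (connected s c tt tt)))
          where
          Vertexʷ = Digraph.IsVertex (threshold G β w)

          some-edge : ∀ {x} → Vertexʷ x → ∃[ a ] ∃[ b ] Edge a b
          some-edge (inj₁ (_ , e , _)) = _ , _ , e
          some-edge (inj₂ (_ , e , _)) = _ , _ , e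

          touched : ∀ {x} → Vertexʷ x →
            (∃[ y ] Σ[ e ∈ Edge y x ] w ≼ β y x e) ⊎ (∃[ y ] Σ[ e ∈ Edge x y ] w ≼ β x y e)
          touched (inj₁ (y , e , w≤e)) = inj₁ (y , e , wrap w≤e)
          touched (inj₂ (y , e , w≤e)) = inj₂ (y , e , wrap w≤e)

          equivalent : ∀ p → Equivalent G β (shift p β)
          equivalent p c = ≋⇒≈ (≋-trans
            (sumAlong-telescopes (λ u v e → β u v e - shift p β u v e) p
              (λ u v e → pointwise-≋ λ n →
                solve 3 (λ b pu pv → b :- (b :+ (pu :- pv)) := pv :- pu) refl
                  (seq (β u v e) n) (seq (p u) n) (seq (p v) n))
              (Cycle.walk c))
            (pointwise-≋ {y = 0ℝ} λ n → solve 1 (λ x → x :- x := con 0ℚ) refl (seq (p (Cycle.v₁ c)) n)))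

          constant : ∀ p → (∀ u v (e : Edge u v) → shift p β u v e ≈ β u v e) →
            ∀ {x y} → Star Edge x y → p x ≋ p y
          constant p γ≈β ε = ≋-refl
          constant p γ≈β (_◅_ {x} {y} e walk) = ≋-trans
            (linear-≋ (≈⇒≋ {shift p β x y e} {β x y e} (γ≈β x y e)) λ n →
              solve 3 (λ b px py → b :+ (px :- py) :+ py := b :+ px) refl
                (seq (β x y e) n) (seq (p x) n) (seq (p y) n))
            (constant p γ≈β walk)

        connected⇒unique : (∀ w → StronglyConnected (threshold G β w)) → IsUniqueBalanced G β
        connected⇒unique threshold-connected = β-balanced , λ γ γ-balanced β∼γ u v e →
          -- From `β - γ = p v - p u` follows that `γ` is `shift p β`; the tail of the given edge
          -- serves as the root.
          let p , d≋ = potential (λ u v e → β u v e - γ u v e) (λ c → ≈⇒≋ (β∼γ c)) connected u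
              γ≋ : ∀ {x y} (f : Edge x y) → γ x y f ≋ shift p β x y f
              γ≋ {x} {y} f = ≋-sym (linear-≋ (d≋ x y f) λ n →
                solve 4 (λ b g px py → b :- g :+ g := py :- px :+ (b :+ (px :- py))) refl
                  (seq (β x y f) n) (seq (γ x y f) n) (seq (p x) n) (seq (p y) n))
              pu≋pv = Th.potential-constant e β p
                (EdgeBalanced-cong {γ} {shift p β} γ≋ (Balanced⇒EdgeBalanced γ γ-balanced))
                (λ w x y x∈ y∈ → Star.map (wrap-heavy {w})
                  (threshold-connected w x y (touching x∈) (touching y∈))) e
          in ≋⇒≈ (≋-trans (γ≋ e) (linear-≋ {y = β u v e} pu≋pv λ n →
               solve 3 (λ b pu pv → pu :+ b := pv :+ (b :+ (pu :- pv))) refl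
                 (seq (β u v e) n) (seq (p u) n) (seq (p v) n)))
          where
          wrap-heavy : ∀ {w x y} → HeavyEdge G β w x y → Σ[ e ∈ Edge x y ] w ≼ β x y e
          wrap-heavy (e , w≤e) = e , wrap w≤e

          touching : ∀ {w x} →
            (∃[ y ] Σ[ e ∈ Edge y x ] w ≼ β y x e) ⊎ (∃[ y ] Σ[ e ∈ Edge x y ] w ≼ β x y e) →
            Digraph.IsVertex (threshold G β w) x
          touching (inj₁ (y , e , w≼e)) = inj₁ (y , e , unwrap w≼e)
          touching (inj₂ (y , e , w≼e)) = inj₂ (y , e , unwrap w≼e)

theorem1 : ExcludedMiddle 0ℓ →
    (G : FiniteDigraph) → StronglyConnected (FiniteDigraph.digraph G) →
    (β : GraphFunction G) → Balanced G β →
    IsUniqueBalanced G β ⇔ (∀ (w : ℝ) → StronglyConnected (threshold G β w))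
theorem1 em G connected β β-balanced =
  mk⇔ (unique⇒connected G connected β β-balanced) (connected⇒unique G connected β β-balanced)
  where open Graphs em
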